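{- Let $n\ge 2$ and let $\bm{m}=(m_1,\dots,m_n)$ be a vector of integers $m_i\ge 1$. Let $D(\bm{m})$ be the integral covering graph of $\bm m$. Then \[\mathrm{box}(D(\bm{m}))=\begin{cases} n & \text{if } \exists i\in [n]\colon m_i\ge 4,\\ n & \text{if } \exists i\in [n]\colon m_i=3 \text{ and } \exists j\in [n]\setminus\{i\}\colon m_j\ge 2,\\ n-1 & \text{if } \exists i\in [n]\colon m_i=3 \text{ and } \forall j\in [n]\setminus\{i\}\colon m_j=1,\\ n & \text{if } \bm{m}=(2,\dots,2),\\ n-1 & \text{if } \bm{m}\in\{1,2\}^n,\ \bm{m}\ne(2,\dots,2) \text{ and } \bm{m}\ne (1,1),\\ 0 & \text{if } \bm{m}=(1,1). \end{cases}\]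
   Context: $[n]=\{1,\dots,n\}$ and $[m]_0=\{0,1,\dots,m\}$. For $\bm{m}\in\mathbb{Z}_{\ge 1}^n$, the integral covering graph $D(\bm{m})$ has vertex set $\prod_{i=1}^n [m_i]_0\setminus\{\bm{0},\bm{m}\}$, where $\bm 0$ is the all-zero vector, and two distinct vertices $\bm v,\bm w$ are adjacent iff $v_i+w_i\ge m_i$ for all $i\in[n]$. The boxicity $\mathrm{box}(G)$ of a finite simple graph $G$ is the minimum integer $d\ge 0$ such that there exist $d$ interval graphs $I_1,\dots,I_d$ on the vertex set $V(G)$ with $E(G)=\bigcap_{j=1}^d E(I_j)$; the empty intersection ($d=0$) is the set of all pairs of vertices, so $\mathrm{box}(G)=0$ iff $G$ is complete. -}

module Defs where

open import Data.Fin using (Fin)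
open import Data.Nat using (ℕ; _+_; _≤_; _≥_)
open import Data.Nat.Properties using (+-comm)
open import Data.Product using (Σ; ∃; _×_; _,_)
open import Data.Rational using (ℚ) renaming (_<_ to _<ℚ_)
open import Data.Refinement using (Refinement; Refinement-syntax; value)
open import Data.Sum using (_⊎_)
open import Data.Vec using (Vec; lookup; replicate)
open import Function.Base using (_∘_)
open import Function.Bundles using (_⇔_)
open import Relation.Binary.PropositionalEquality
  using (_≡_; _≢_; refl; sym; subst)
open import Relation.Nullary using (¬_)

-- Dedekind reals: two-sided, rounded, located cuts of ℚ.
record ℝ : Set₁ where
  field
    Lower Upper     : ℚ → Set
    lower-inhabited : ∃ Lower
    upper-inhabited : ∃ Upper
    lower-rounded   : ∀ q → Lower q ⇔ ∃ λ r → q <ℚ r × Lower r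
    upper-rounded   : ∀ q → Upper q ⇔ ∃ λ r → r <ℚ q × Upper r
    disjoint        : ∀ q → ¬ (Lower q × Upper q)
    located         : ∀ q r → q <ℚ r → Lower q ⊎ Upper r

infix 4 _≤ℝ_

_≤ℝ_ : ℝ → ℝ → Set
x ≤ℝ y = ∀ q → ℝ.Lower x q → ℝ.Lower y q

record ClosedInterval : Set₁ where
  field
    left right : ℝ
    left≤right : left ≤ℝ right

infix 4 _∈ᴵ_

_∈ᴵ_ : ℝ → ClosedInterval → Set
x ∈ᴵ I = ClosedInterval.left I ≤ℝ x × x ≤ℝ ClosedInterval.right I

Intersect : ClosedInterval → ClosedInterval → Set₁
Intersect I J = ∃ λ x → x ∈ᴵ I × x ∈ᴵ J

record SimpleGraph (V : Set) : Set₁ where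
  field
    Adj    : V → V → Set
    symm   : ∀ {v w} → Adj v w → Adj w v
    irrefl : ∀ {v} → ¬ Adj v v

open SimpleGraph public using (Adj)

IsIntervalGraph : {V : Set} → SimpleGraph V → Set₁
IsIntervalGraph {V} G =
  Σ (V → ClosedInterval) λ I →
    ∀ v w → v ≢ w → Adj G v w ⇔ Intersect (I v) (I w)

-- Edge sets are compared on pairs of distinct vertices, so that the empty
-- intersection (d = 0) is the edge set of the complete graph.
IsIntersectionOfIntervalGraphs : {V : Set} → SimpleGraph V → ℕ → Set₁
IsIntersectionOfIntervalGraphs {V} G d =
  Σ (Fin d → SimpleGraph V) λ I →
    (∀ j → IsIntervalGraph (I j)) ×
    (∀ v w → v ≢ w → Adj G v w ⇔ (∀ j → Adj (I j) v w))

-- box(G) = d, as a relation, since the minimum cannot be computed in general.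
IsBoxicity : {V : Set} → SimpleGraph V → ℕ → Set₁
IsBoxicity G d =
  IsIntersectionOfIntervalGraphs G d ×
  (∀ d′ → IsIntersectionOfIntervalGraphs G d′ → d ≤ d′)

-- The membership proof in a refinement type is irrelevant, so two vertices
-- are equal exactly when their coordinate vectors are.
Vertex : {n : ℕ} → Vec ℕ n → Set
Vertex {n} m =
  [ v ∈ Vec ℕ n ∣ (∀ i → lookup v i ≤ lookup m i) × v ≢ replicate n 0 × v ≢ m ]

D : {n : ℕ} (m : Vec ℕ n) → SimpleGraph (Vertex m)
D m = record
  { Adj    = λ v w → v ≢ w ×
               (∀ i → lookup (value v) i + lookup (value w) i ≥ lookup m i)
  ; symm   = λ {v} {w} (v≢w , cover) → v≢w ∘ sym , λ i →
               subst (lookup m i ≤_)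
                     (+-comm (lookup (value v) i) (lookup (value w) i))
                     (cover i)
  ; irrefl = λ (v≢v , _) → v≢v refl
  }

{-# OPTIONS --safe #-}
module Submission where

-- In complement coordinates u = m − v, two vertices are adjacent iff the sum of
-- their complements is at most m.
--
-- Lower bounds.  "Entirely to the left of" is an interval order on the vertices
-- of an interval graph, so two non-edges whose four cross pairs are edges cannot
-- both be non-edges of one interval graph; pairwise conflicting non-edges, most
-- of them of the form m_j e_j, m_j e_j + e_t, then need distinct interval
-- graphs.  For m = (1,…,1) conflicts alone do not suffice: there each interval
-- graph separates at most max(n+1, 5) of the n(n−1) pairs e_i, e_i + e_k.
--
-- Upper bounds.  Each coordinate gives a threshold graph, which is an interval
-- graph.  If m_z = 1 and the other bounds are 1 or 2, or 1 apart from a single 3,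
-- then a non-edge failing only at z has ends that differ at another coordinate c,
-- and the drawing of c has room to separate them: no graph for z is needed.

open import Defs
open import Algebra.Properties.CommutativeSemigroup using (interchange)
open import Data.Empty using (⊥; ⊥-elim)
open import Data.Fin using (Fin; zero; suc; punchIn; punchOut; remQuot; combine)
import Data.Fin as Fin
open import Data.Fin.Properties
  using (any?; combine-remQuot; injective⇒≤; pigeonhole; punchIn-injective;
         punchIn-punchOut; punchInᵢ≢i; sequence)
import Data.Fin.Properties as Fin
open import Data.Integer using (+_; -[1+_]; +<+; +≤+; -<+)
import Data.Integer as ℤ
import Data.Integer.Properties as ℤ
open import Data.Irrelevant using () renaming ([_] to irr[_])
open import Data.List using (List; []; _∷_; _++_; map; allFin; length)
import Data.List as List
open import Data.List.Membership.Propositional using (_∈_)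
open import Data.List.Membership.Propositional.Properties using (∈-++⁺ˡ; ∈-++⁺ʳ; ∈-map⁺; ∈-allFin)
open import Data.List.Properties using (length-map; length-++; length-tabulate)
open import Data.List.Relation.Unary.Any using (here; there; index)
open import Data.List.Relation.Unary.Any.Properties using (lookup-index)
open import Data.Nat
open import Data.Nat.Coprimality using (1-coprimeTo) renaming (sym to coprime-sym)
open import Data.Nat.Properties
open import Data.Nat.Tactic.RingSolver using (solve-∀)
open import Data.Product using (∃; ∃₂; _×_; _,_; proj₁; proj₂)
open import Data.Rational using (ℚ; mkℚ; *<*; *≤*) renaming (_<_ to _<ℚ_; _≤_ to _≤ℚ_)
import Data.Rational.Properties as ℚ
open import Data.Refinement using (value; value-injective) renaming (_,_ to _⟨,⟩_)
open import Data.Sum using (_⊎_; inj₁; inj₂; [_,_]′)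
import Data.Sum as Sum
open import Data.Vec using (Vec; []; _∷_; lookup; replicate; tabulate; toList)
open import Data.Vec.Properties using (lookup∘tabulate; lookup-replicate; ≡-dec)
open import Data.Vec.Relation.Binary.Pointwise.Extensional using (ext; Pointwise-≡⇒≡)
open import Effect.Monad using (RawMonad)
open import Function.Base using (_∘_; id)
open import Function.Bundles using (mk⇔; Equivalence)
open import Level using (Level; 0ℓ)
open import Relation.Binary using (Rel; Decidable)
open import Relation.Binary.PropositionalEquality
  using (_≡_; _≢_; refl; sym; trans; cong; cong₂; subst; subst₂; module ≡-Reasoning)
open import Relation.Nullary
open import Relation.Nullary.Decidable using (map′; ¬¬-excluded-middle)
open import Relation.Nullary.Negation using (¬¬-Monad; ¬¬-map)
open import Relation.Nullary.Recomputable using (¬-recompute)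

open ClosedInterval
open Equivalence using (to; from)
open ℝ

private variable
  ℓ : Level
  n : ℕ

-- Interval graphs as interval orders

infixl 1 _>>=_

_>>=_ : {A B : Set ℓ} → ¬ ¬ A → (A → ¬ ¬ B) → ¬ ¬ B
(¬¬a >>= f) ¬b = ¬¬a λ a → f a ¬b

-- Over a finite index set doubly negated facts can be had all at once. Thus the lower bounds may
-- argue classically about interval graphs whose adjacency is undecided.
¬¬-choice : {P : Fin n → Set ℓ} → (∀ i → ¬ ¬ P i) → ¬ ¬ (∀ i → P i)
¬¬-choice = sequence (RawMonad.rawApplicative ¬¬-Monad)

≤ℝ-refl : ∀ {x} → x ≤ℝ x
≤ℝ-refl _ l = l

≤ℝ-trans : ∀ {x y z} → x ≤ℝ y → y ≤ℝ z → x ≤ℝ z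
≤ℝ-trans x≤y y≤z q = y≤z q ∘ x≤y q

lower-downward : ∀ x {q r} → q <ℚ r → Lower x r → Lower x q
lower-downward x {q} {r} q<r l = from (lower-rounded x q) (r , q<r , l)

-- Roundedness provides some `r` above `q` in the lower cut of `x`. Locatedness of `y` between them
-- decides, and the doubly negated inequality excludes the case that `r` bounds `y` from above.
≤ℝ-stable : ∀ x y → ¬ ¬ (x ≤ℝ y) → x ≤ℝ y
≤ℝ-stable x y ¬¬x≤y q xq with to (lower-rounded x q) xq
... | r , q<r , xr with located y q r q<r
...   | inj₁ yq = yq
...   | inj₂ yr = ⊥-elim (¬¬x≤y λ x≤y → disjoint y r (x≤y r xr , yr))

≤ℝ-total : ∀ x y → ¬ ¬ (x ≤ℝ y ⊎ y ≤ℝ x)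
≤ℝ-total x y k = k (inj₂ (≤ℝ-stable y x λ y≰x → k (inj₁ (x≤y y≰x))))
  where
  -- A rational in the cut of x but not in that of y would bound y, hence y ≤ℝ x.
  x≤y : ¬ (y ≤ℝ x) → x ≤ℝ y
  x≤y y≰x q xq with to (lower-rounded x q) xq
  ... | r , q<r , xr with located y q r q<r
  ...   | inj₁ yq = yq
  ...   | inj₂ yr = ⊥-elim (y≰x λ s ys → [ (λ s<r → lower-downward x s<r xr)
                                          , (λ r≤s → ⊥-elim (below ys r≤s)) ]′ (cmp s))
    where
    cmp : ∀ s → s <ℚ r ⊎ r ≤ℚ s
    cmp s with s ℚ.<? r
    ... | yes s<r = inj₁ s<r
    ... | no  s≮r = inj₂ (ℚ.≮⇒≥ s≮r)
    below : ∀ {s} → Lower y s → r ≤ℚ s → ⊥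
    below {s} ys r≤s with to (lower-rounded y s) ys
    ... | t , s<t , yt = disjoint y r (lower-downward y (ℚ.≤-<-trans r≤s s<t) yt , yr)

-- Natural numbers as Dedekind reals

fromℕ : ℕ → ℚ
fromℕ k = mkℚ (+ k) 0 (coprime-sym (1-coprimeTo k))

fromℕ-mono-≤ : ∀ {k l} → k ≤ l → fromℕ k ≤ℚ fromℕ l
fromℕ-mono-≤ {k} {l} k≤l =
  *≤* (subst₂ ℤ._≤_ (sym (ℤ.*-identityʳ (+ k))) (sym (ℤ.*-identityʳ (+ l))) (+≤+ k≤l))

fromℕ-mono-< : ∀ {k l} → k < l → fromℕ k <ℚ fromℕ l
fromℕ-mono-< {k} {l} k<l =
  *<* (subst₂ ℤ._<_ (sym (ℤ.*-identityʳ (+ k))) (sym (ℤ.*-identityʳ (+ l))) (+<+ k<l))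

real : ℕ → ℝ
real k = record
  { Lower           = _<ℚ fromℕ k
  ; Upper           = fromℕ k <ℚ_
  ; lower-inhabited = mkℚ -[1+ 0 ] 0 (1-coprimeTo 1) ,
                      *<* (subst (ℤ._<_ _) (sym (ℤ.*-identityʳ (+ k))) -<+)
  ; upper-inhabited = fromℕ (suc k) , fromℕ-mono-< (n<1+n k)
  ; lower-rounded   = λ q → mk⇔ (λ q<k → let r , q<r , r<k = ℚ.<-dense q<k in r , q<r , r<k)
                                (λ (r , q<r , r<k) → ℚ.<-trans q<r r<k)
  ; upper-rounded   = λ q → mk⇔ (λ k<q → let r , k<r , r<q = ℚ.<-dense k<q in r , r<q , k<r)
                                (λ (r , r<q , k<r) → ℚ.<-trans k<r r<q)
  ; disjoint        = λ q (q<k , k<q) → ℚ.<-asym q<k k<q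
  ; located         = loc
  }
  where
  loc : ∀ q r → q <ℚ r → q <ℚ fromℕ k ⊎ fromℕ k <ℚ r
  loc q r q<r with q ℚ.<? fromℕ k
  ... | yes q<k = inj₁ q<k
  ... | no  q≮k = inj₂ (ℚ.≤-<-trans (ℚ.≮⇒≥ q≮k) q<r)

real-mono : ∀ {k l} → k ≤ l → real k ≤ℝ real l
real-mono k≤l q q<k = ℚ.<-≤-trans q<k (fromℕ-mono-≤ k≤l)

real-cancel : ∀ {k l} → real k ≤ℝ real l → k ≤ l
real-cancel {k} {l} k≤l with k ≤? l
... | yes p = p
... | no ¬p = ⊥-elim (ℚ.<-irrefl refl (k≤l (fromℕ l) (fromℕ-mono-< (≰⇒> ¬p))))

intersect⇒≤ : ∀ {I J} → Intersect I J → left I ≤ℝ right J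
intersect⇒≤ {I} {J} (x , (l≤x , _) , (_ , x≤r)) = ≤ℝ-trans {left I} {x} {right J} l≤x x≤r

-- The common point is the larger of the two left ends. Which one this is cannot be decided for
-- cuts, hence the double negation.
≤⇒¬¬intersect : ∀ {I J} → left I ≤ℝ right J → left J ≤ℝ right I → ¬ ¬ Intersect I J
≤⇒¬¬intersect {I} {J} I≤J J≤I = ¬¬-map meet (≤ℝ-total (left I) (left J))
  where
  meet : left I ≤ℝ left J ⊎ left J ≤ℝ left I → Intersect I J
  meet (inj₁ p) = left J , (p , J≤I) , (≤ℝ-refl {left J} , left≤right J)
  meet (inj₂ p) = left I , (≤ℝ-refl {left I} , left≤right I) , (p , I≤J)

-- The relation "entirely to the left of" of an interval representation; it
-- carries all that the lower bounds need to know about interval graphs.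
record IntervalOrder {V : Set} (A : V → V → Set) : Set₁ where
  field
    _⊏_     : V → V → Set
    ⊏-irr   : ∀ {v} → ¬ v ⊏ v
    ⊏-apart : ∀ {v w} → v ≢ w → A v w → ¬ v ⊏ w
    ferrers : ∀ {a b c d} → a ⊏ b → c ⊏ d → ¬ ¬ (a ⊏ d ⊎ c ⊏ b)
    ⊏-cover : ∀ {v w} → v ≢ w → ¬ A v w → ¬ ¬ (v ⊏ w ⊎ w ⊏ v)

intervalOrder : {V : Set} {G : SimpleGraph V} → IsIntervalGraph G → IntervalOrder (Adj G)
intervalOrder {V} {G} (I , spec) = record
  { _⊏_     = _⊏_
  ; ⊏-irr   = λ {v} v⊏v → v⊏v (left≤right (I v))
  ; ⊏-apart = λ v≢w vw v⊏w → v⊏w (intersect⇒≤ {I _} {I _} (to (spec _ _ (v≢w ∘ sym)) (SimpleGraph.symm G vw)))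
  ; ferrers = fer
  ; ⊏-cover = cov
  }
  where
  L R : V → ℝ
  L v = left (I v)
  R v = right (I v)
  _⊏_ : V → V → Set
  -- The strict inequality `R v < L w`, in negative form.
  v ⊏ w = ¬ (L w ≤ℝ R v)
  fer : ∀ {a b c d} → a ⊏ b → c ⊏ d → ¬ ¬ (a ⊏ d ⊎ c ⊏ b)
  -- Whichever of `a` and `c` ends first lies to the left of both `b` and `d`.
  fer {a} {b} {c} {d} a⊏b c⊏d k = ≤ℝ-total (R a) (R c)
    [ (λ a≤c → k (inj₁ λ d≤a → c⊏d (≤ℝ-trans {L d} {R a} {R c} d≤a a≤c)))
    , (λ c≤a → k (inj₂ λ b≤c → a⊏b (≤ℝ-trans {L b} {R c} {R a} b≤c c≤a))) ]′
  cov : ∀ {v w} → v ≢ w → ¬ Adj G v w → ¬ ¬ (v ⊏ w ⊎ w ⊏ v)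
  cov {v} {w} v≢w ¬vw k = k (inj₁ λ w≤v → k (inj₂ λ v≤w →
    ≤⇒¬¬intersect {I v} {I w} v≤w w≤v (¬vw ∘ from (spec v w v≢w))))

-- Interval drawings on the natural numbers

-- Points drawn at the same place are understood to be distinct: they are
-- separated afterwards, so that points are always pairwise disjoint.
data Shape : Set where
  point : ℕ → Shape
  span  : ∀ l h → l ≤ h → Shape

Meets : Shape → Shape → Set
Meets (point _)    (point _)      = ⊥
Meets (point p)    (span l h _)   = l ≤ p × p ≤ h
Meets (span l h _) (point p)      = l ≤ p × p ≤ h
Meets (span l h _) (span l′ h′ _) = l ≤ h′ × l′ ≤ h

Meets-sym : ∀ s t → Meets s t → Meets t s
Meets-sym (point _)    (span _ _ _) m         = m
Meets-sym (span _ _ _) (point _)    m         = m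
Meets-sym (span _ _ _) (span _ _ _) (p , q)   = q , p

meets? : ∀ s t → Dec (Meets s t)
meets? (point _)    (point _)      = no λ ()
meets? (point p)    (span l h _)   = l ≤? p ×-dec p ≤? h
meets? (span l h _) (point p)      = l ≤? p ×-dec p ≤? h
meets? (span l h _) (span l′ h′ _) = l ≤? h′ ×-dec l′ ≤? h

-- Read `x * suc k + a` as a two-digit numeral in base `suc k`: a smaller leading digit on the right
-- would outweigh any last digit `b ≤ k`.
≤-scale⁻ : ∀ {x y a b k} → b ≤ k → x * suc k + a ≤ y * suc k + b → x ≤ y
≤-scale⁻ {x} {y} {a} {b} {k} b≤k le with x ≤? y
... | yes p = p
... | no ¬p = ⊥-elim (<⇒≱ (begin-strict
  y * suc k + b     <⟨ +-monoʳ-< (y * suc k) (s≤s b≤k) ⟩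
  y * suc k + suc k ≡⟨ +-comm (y * suc k) (suc k) ⟩
  suc y * suc k     ≤⟨ *-monoˡ-≤ (suc k) (≰⇒> ¬p) ⟩
  x * suc k         ≤⟨ m≤m+n _ a ⟩
  x * suc k + a     ∎) le)
  where open ≤-Reasoning

scale-mono : ∀ {x y a b} k → x ≤ y → a ≤ b → x * suc k + a ≤ y * suc k + b
scale-mono k x≤y a≤b = +-mono-≤ (*-monoˡ-≤ (suc k) x≤y) a≤b

scale-injective : ∀ {x y a b k} → a ≤ k → b ≤ k →
  x * suc k + a ≡ y * suc k + b → x ≡ y × a ≡ b
scale-injective {x} {y} {a} {b} {k} a≤k b≤k eq
  with ≤-antisym (≤-scale⁻ {x} {y} b≤k (≤-reflexive eq))
                 (≤-scale⁻ {y} {x} a≤k (≤-reflexive (sym eq)))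
... | refl = refl , +-cancelˡ-≡ (x * suc k) a b eq

-- Each position of the drawing is blown up to a block of `suc k` numbers. A span fills its blocks,
-- while a point takes the place given by its identifier, so that distinct points at one position
-- come apart.
module _ {V : Set} {k : ℕ} (id′ : V → ℕ) (id≤k : ∀ v → id′ v ≤ k)
         (id-injective : ∀ {v w} → id′ v ≡ id′ w → v ≡ w) (shape : V → Shape) where

  private
    lo hi : Shape → ℕ → ℕ
    lo (point p)    a = p * suc k + a
    lo (span l h _) a = l * suc k + 0
    hi (point p)    a = p * suc k + a
    hi (span l h _) a = h * suc k + k

    lo≤hi : ∀ s a → lo s a ≤ hi s a
    lo≤hi (point p)      a = ≤-refl
    lo≤hi (span l h l≤h) a = scale-mono k l≤h z≤n

    cross⁺ : ∀ s t {a b} → a ≤ k → b ≤ k → Meets s t → lo s a ≤ hi t b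
    cross⁺ (point p)    (span l h _)   a≤k b≤k (_ , p≤h) = scale-mono k p≤h a≤k
    cross⁺ (span l h _) (point p)      a≤k b≤k (l≤p , _) = scale-mono k l≤p z≤n
    cross⁺ (span l h _) (span l′ h′ _) a≤k b≤k (l≤h′ , _) = scale-mono k l≤h′ z≤n

    cross⁻ : ∀ s t {a b} → a ≤ k → b ≤ k → a ≢ b →
      lo s a ≤ hi t b → lo t b ≤ hi s a → Meets s t
    cross⁻ (point p)    (point q)      a≤k b≤k a≢b x y =
      a≢b (proj₂ (scale-injective {p} {q} a≤k b≤k (≤-antisym x y)))
    cross⁻ (point p)    (span l h _)   a≤k b≤k a≢b x y =
      ≤-scale⁻ {l} {p} a≤k y , ≤-scale⁻ {p} {h} ≤-refl x
    cross⁻ (span l h _) (point p)      a≤k b≤k a≢b x y =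
      ≤-scale⁻ {l} {p} b≤k x , ≤-scale⁻ {p} {h} ≤-refl y
    cross⁻ (span l h _) (span l′ h′ _) a≤k b≤k a≢b x y =
      ≤-scale⁻ {l} {h′} ≤-refl x , ≤-scale⁻ {l′} {h} ≤-refl y

  shapeGraph : SimpleGraph V
  shapeGraph = record
    { Adj    = λ v w → v ≢ w × Meets (shape v) (shape w)
    ; symm   = λ {v} {w} (v≢w , m) → v≢w ∘ sym , Meets-sym (shape v) (shape w) m
    ; irrefl = λ (v≢v , _) → v≢v refl
    }

  shapeGraph-interval : IsIntervalGraph shapeGraph
  shapeGraph-interval = I , λ v w v≢w → mk⇔ (fwd v w) (bwd v w v≢w)
    where
    I : V → ClosedInterval
    I v = record
      { left       = real (lo (shape v) (id′ v))
      ; right      = real (hi (shape v) (id′ v))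
      ; left≤right = real-mono (lo≤hi (shape v) (id′ v))
      }
    bwd : ∀ v w → v ≢ w → Intersect (I v) (I w) → v ≢ w × Meets (shape v) (shape w)
    bwd v w v≢w (x , (vl , vr) , (wl , wr)) = v≢w ,
      cross⁻ (shape v) (shape w) (id≤k v) (id≤k w) (v≢w ∘ id-injective)
        (real-cancel (≤ℝ-trans {left (I v)} {x} {right (I w)} vl wr))
        (real-cancel (≤ℝ-trans {left (I w)} {x} {right (I v)} wl vr))
    fwd : ∀ v w → v ≢ w × Meets (shape v) (shape w) → Intersect (I v) (I w)
    fwd v w (_ , m) with ≤-total (lo (shape v) (id′ v)) (lo (shape w) (id′ w))
    ... | inj₁ v≤w = left (I w) ,
      (real-mono v≤w , real-mono (cross⁺ (shape w) (shape v) (id≤k w) (id≤k v) (Meets-sym (shape v) (shape w) m))) ,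
      (≤ℝ-refl {left (I w)} , left≤right (I w))
    ... | inj₂ w≤v = left (I v) ,
      (≤ℝ-refl {left (I v)} , left≤right (I v)) ,
      (real-mono w≤v , real-mono (cross⁺ (shape v) (shape w) (id≤k v) (id≤k w) m))

-- A mixed-radix numeral with digits bounded by `m`, hence injective on the vectors below `m`; it
-- supplies the identifiers that separate points.
code : Vec ℕ n → Vec ℕ n → ℕ
code []       []       = 0
code (m ∷ ms) (v ∷ vs) = code ms vs * suc m + v

code-bound : Vec ℕ n → ℕ
code-bound []       = 0
code-bound (m ∷ ms) = code-bound ms * suc m + m

code≤bound : ∀ (m v : Vec ℕ n) → (∀ i → lookup v i ≤ lookup m i) → code m v ≤ code-bound m
code≤bound []       []       _   = z≤n
code≤bound (m ∷ ms) (v ∷ vs) v≤m = scale-mono m (code≤bound ms vs (v≤m ∘ suc)) (v≤m zero)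

code-injective : ∀ (m v w : Vec ℕ n) → (∀ i → lookup v i ≤ lookup m i) →
  (∀ i → lookup w i ≤ lookup m i) → code m v ≡ code m w → v ≡ w
code-injective []       []       []       _   _   _  = refl
code-injective (m ∷ ms) (v ∷ vs) (w ∷ ws) v≤m w≤m eq
  with scale-injective {code ms vs} {code ms ws} (v≤m zero) (w≤m zero) eq
... | eqs , refl = cong (v ∷_) (code-injective ms vs ws (v≤m ∘ suc) (w≤m ∘ suc) eqs)

-- The membership proof is irrelevant, but the bound can be recomputed because `≤` is decidable.
value≤ : ∀ {m : Vec ℕ n} (v : Vertex m) i → lookup (value v) i ≤ lookup m i
value≤ (_ ⟨,⟩ irr[ p ]) i = recompute (_ ≤? _) (proj₁ p i)

-- The last hypothesis sees all drawings at once, since a failure at one coordinate may be detected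
-- by the drawing of another.
shapes⇒intersection : ∀ (m : Vec ℕ n) {d} (shape : Fin d → Vertex m → Shape) →
  (∀ {v w} j → v ≢ w → Adj (D m) v w → Meets (shape j v) (shape j w)) →
  (∀ {v w} → v ≢ w → (∀ j → Meets (shape j v) (shape j w)) → ∀ i →
     lookup (value v) i + lookup (value w) i ≥ lookup m i) →
  IsIntersectionOfIntervalGraphs (D m) d
shapes⇒intersection m shape meet cover =
  (λ j → shapeGraph ident ident≤ ident-inj (shape j)) ,
  (λ j → shapeGraph-interval ident ident≤ ident-inj (shape j)) ,
  λ v w v≢w → mk⇔ (λ vw j → v≢w , meet j v≢w vw) (λ ms → v≢w , cover v≢w (proj₂ ∘ ms))
  where
  ident : Vertex m → ℕ
  ident v = code m (value v)
  ident≤ : ∀ v → ident v ≤ code-bound m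
  ident≤ v = code≤bound m (value v) (value≤ v)
  ident-inj : ∀ {v w} → ident v ≡ ident w → v ≡ w
  ident-inj {v} {w} eq = value-injective (code-injective m _ _ (value≤ v) (value≤ w) eq)

-- Upper bounds

_at_ : {m : Vec ℕ n} → Vertex m → Fin n → ℕ
v at i = lookup (value v) i

vertex-≗ : {m : Vec ℕ n} {v w : Vertex m} → (∀ i → v at i ≡ w at i) → v ≡ w
vertex-≗ eq = value-injective (Pointwise-≡⇒≡ (ext eq))

-- Values below `M / 2` never cover `M` together and become points; the others always do, and their
-- spans share 0. A point `M ∸ x` lies in the span from 0 to `y` exactly when `x + y ≥ M`.
thresholdShape : ℕ → ℕ → Shape
thresholdShape M x with x + x <? M
... | yes _ = point (M ∸ x)
... | no  _ = span 0 x z≤n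

private
  ∸≤⇒≤+ : ∀ M x y → M ∸ x ≤ y → M ≤ x + y
  ∸≤⇒≤+ M x y le = ≤-trans (m≤n+m∸n M x) (+-monoʳ-≤ x le)

  ≤+⇒∸≤ : ∀ M x y → M ≤ x + y → M ∸ x ≤ y
  ≤+⇒∸≤ M x y le = subst (M ∸ x ≤_) (m+n∸m≡n x y) (∸-monoˡ-≤ x le)

threshold-meets⁺ : ∀ M x y → x + y ≥ M → Meets (thresholdShape M x) (thresholdShape M y)
threshold-meets⁺ M x y le with x + x <? M | y + y <? M
... | yes p | yes q = <⇒≱ ([ (λ x≤y → ≤-<-trans (+-monoˡ-≤ y x≤y) q)
                            , (λ y≤x → ≤-<-trans (+-monoʳ-≤ x y≤x) p) ]′ (≤-total x y)) le
... | yes p | no q  = z≤n , ≤+⇒∸≤ M x y le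
... | no p  | yes q = z≤n , ≤+⇒∸≤ M y x (subst (M ≤_) (+-comm x y) le)
... | no p  | no q  = z≤n , z≤n

threshold-meets⁻ : ∀ M x y → Meets (thresholdShape M x) (thresholdShape M y) → x + y ≥ M
threshold-meets⁻ M x y ms with x + x <? M | y + y <? M
... | yes p | no q  = ∸≤⇒≤+ M x y (proj₂ ms)
... | no p  | yes q = subst (M ≤_) (+-comm y x) (∸≤⇒≤+ M y x (proj₂ ms))
... | no p  | no q with ≤-total x y
...   | inj₁ x≤y = ≤-trans (≮⇒≥ p) (+-monoʳ-≤ x x≤y)
...   | inj₂ y≤x = ≤-trans (≮⇒≥ q) (+-monoˡ-≤ y y≤x)

box≤n : (m : Vec ℕ n) → IsIntersectionOfIntervalGraphs (D m) n
box≤n m = shapes⇒intersection m (λ i v → thresholdShape (lookup m i) (v at i))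
  (λ i _ (_ , cover) → threshold-meets⁺ _ _ _ (cover i))
  (λ _ ms i → threshold-meets⁻ _ _ _ (ms i))

-- Interval drawing of a coordinate with bound M ∈ {1, 2} (first value),
-- refined by a coordinate with bound 1 (second value).
kindShape : ℕ → ℕ → ℕ → Shape
kindShape M x z with x ≟ 0 | x ≟ M | z ≟ 0
... | yes _ | _     | yes _ = point 3
... | yes _ | _     | no _  = point 0
... | no _  | yes _ | yes _ = span 0 1 z≤n
... | no _  | yes _ | no _  = span 0 3 z≤n
... | no _  | no _  | yes _ = span 2 2 ≤-refl
... | no _  | no _  | no _  = span 1 2 (s≤s z≤n)

-- Meeting may leave the bound 1 uncovered only when `x ≡ y`; such a pair is left to a coordinate
-- where the vertices differ.
KindSpec : ℕ → ℕ → ℕ → ℕ → ℕ → Set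
KindSpec M x y p q =
  (M ≤ x + y × 1 ≤ p + q → Meets (kindShape M x p) (kindShape M y q)) ×
  (Meets (kindShape M x p) (kindShape M y q) → M ≤ x + y × (1 ≤ p + q ⊎ x ≡ y))

kindSpec? : ∀ M x y p q → Dec (KindSpec M x y p q)
kindSpec? M x y p q =
  (((M ≤? x + y) ×-dec (1 ≤? p + q)) →-dec meets? (kindShape M x p) (kindShape M y q)) ×-dec
  (meets? (kindShape M x p) (kindShape M y q) →-dec ((M ≤? x + y) ×-dec ((1 ≤? p + q) ⊎-dec (x ≟ y))))

kindSpecs? : ∀ M → Dec (∀ {x} → x < suc M → ∀ {y} → y < suc M →
  ∀ {p} → p < 2 → ∀ {q} → q < 2 → KindSpec M x y p q)
kindSpecs? M = allUpTo? (λ x → allUpTo? (λ y →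
  allUpTo? (λ p → allUpTo? (λ q → kindSpec? M x y p q) 2) 2) (suc M)) (suc M)

kindSpec : ∀ {M} → M ≡ 1 ⊎ M ≡ 2 → ∀ {x y p q} → x ≤ M → y ≤ M → p ≤ 1 → q ≤ 1 → KindSpec M x y p q
kindSpec (inj₁ refl) x y p q = from-yes (kindSpecs? 1) (s≤s x) (s≤s y) (s≤s p) (s≤s q)
kindSpec (inj₂ refl) x y p q = from-yes (kindSpecs? 2) (s≤s x) (s≤s y) (s≤s p) (s≤s q)

-- Coordinate `z` gets no drawing. If two vertices differ at another coordinate, its drawing
-- enforces the bound at `z`; otherwise they differ at `z`, where one of them has value 1.
box≤n-1 : (m : Vec ℕ (suc n)) → (∀ i → lookup m i ≡ 1 ⊎ lookup m i ≡ 2) →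
  ∀ z → lookup m z ≡ 1 → IsIntersectionOfIntervalGraphs (D m) n
box≤n-1 {n} m m12 z mz≡1 = shapes⇒intersection m
  (λ j v → kindShape (lookup m (punchIn z j)) (v at punchIn z j) (v at z))
  (λ {v} {w} j _ (_ , cover) → proj₁ (spec v w j) (cover (punchIn z j) , subst (_≤ v at z + w at z) mz≡1 (cover z)))
  cov
  where
  ≤1 : ∀ (v : Vertex m) → v at z ≤ 1
  ≤1 v = subst (v at z ≤_) mz≡1 (value≤ v z)
  spec : ∀ (v w : Vertex m) j → KindSpec (lookup m (punchIn z j)) (v at punchIn z j) (w at punchIn z j) (v at z) (w at z)
  spec v w j = kindSpec (m12 (punchIn z j)) (value≤ v _) (value≤ w _) (≤1 v) (≤1 w)
  distinct≤1 : ∀ {p q} → p ≤ 1 → q ≤ 1 → p ≢ q → 1 ≤ p + q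
  distinct≤1 {zero}  {zero}  _ _ p≢q = ⊥-elim (p≢q refl)
  distinct≤1 {zero}  {suc q} _ _ _   = s≤s z≤n
  distinct≤1 {suc p} {q}     _ _ _   = s≤s z≤n
  cov : ∀ {v w : Vertex m} → v ≢ w →
    (∀ j → Meets (kindShape (lookup m (punchIn z j)) (v at punchIn z j) (v at z))
                 (kindShape (lookup m (punchIn z j)) (w at punchIn z j) (w at z))) →
    ∀ i → v at i + w at i ≥ lookup m i
  cov {v} {w} v≢w ms i with z Fin.≟ i
  ... | no z≢i = subst (λ k → v at k + w at k ≥ lookup m k) (punchIn-punchOut z≢i)
                   (proj₁ (proj₂ (spec v w (punchOut z≢i)) (ms (punchOut z≢i))))
  ... | yes refl rewrite mz≡1 with any? (λ j → ¬? (v at punchIn z j ≟ w at punchIn z j))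
  ...   | yes (j , v≢wⱼ) = [ id , ⊥-elim ∘ v≢wⱼ ]′ (proj₂ (proj₂ (spec v w j) (ms j)))
  ...   | no same = distinct≤1 (≤1 v) (≤1 w) λ v≡wz → v≢w (vertex-≗ (agree v≡wz))
    where
    agree : v at z ≡ w at z → ∀ k → v at k ≡ w at k
    agree v≡wz k with z Fin.≟ k
    ... | yes refl = v≡wz
    ... | no z≢k = subst (λ k → v at k ≡ w at k) (punchIn-punchOut z≢k)
                     (decidable-stable (_ ≟ _) λ ne → same (punchOut z≢k , ne))

-- x has bound 3, y and z have bound 1.  A non-edge failing at x or z is left to
-- the side drawing of a coordinate y at which its ends differ, or to the path
-- drawing of x if there is none.  In the side drawing the spans meet at 4, and
-- the points with y = 0 lie to the right or to the left of 4 according to z.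
sideShape : ℕ → ℕ → ℕ → Shape
sideShape x zero    zero    = point (8 ∸ x)
sideShape x zero    (suc _) = point x
sideShape x (suc _) zero    = span (3 ∸ x) 4 (≤-trans (m∸n≤m 3 x) (n≤1+n 3))
sideShape x (suc _) (suc _) = span (3 ∸ x) (5 + x) (≤-trans (m∸n≤m 3 x) (≤-trans (m≤m+n 3 2) (m≤m+n 5 x)))

-- For `y ≢ y′` a point faces a span. The point is at `x` or `8 ∸ x`, and the span's left end
-- `3 ∸ x′` and right end `5 + x′` are reached exactly when `x + x′ ≥ 3`; a span with `z′` zero
-- stops at 4, short of the points on the right.
SideSpec : (x x′ y y′ z z′ : ℕ) → Set
SideSpec x x′ y y′ z z′ =
  (3 ≤ x + x′ × 1 ≤ y + y′ × 1 ≤ z + z′ → Meets (sideShape x y z) (sideShape x′ y′ z′)) ×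
  (Meets (sideShape x y z) (sideShape x′ y′ z′) →
    1 ≤ y + y′ × (y ≢ y′ → 3 ≤ x + x′ × 1 ≤ z + z′))

sideSpec : ∀ {x x′ y y′ z z′} → x ≤ 3 → x′ ≤ 3 → y ≤ 1 → y′ ≤ 1 → z ≤ 1 → z′ ≤ 1 →
  SideSpec x x′ y y′ z z′
sideSpec a b c d e f =
  from-yes (allUpTo? (λ x → allUpTo? (λ x′ → allUpTo? (λ y → allUpTo? (λ y′ →
            allUpTo? (λ z → allUpTo? (λ z′ → dec x x′ y y′ z z′) 2) 2) 2) 2) 4) 4)
    (s≤s a) (s≤s b) (s≤s c) (s≤s d) (s≤s e) (s≤s f)
  where
  dec : ∀ x x′ y y′ z z′ → Dec (SideSpec x x′ y y′ z z′)
  dec x x′ y y′ z z′ = let meet = meets? (sideShape x y z) (sideShape x′ y′ z′) in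
    (((3 ≤? x + x′) ×-dec (1 ≤? y + y′) ×-dec (1 ≤? z + z′)) →-dec meet) ×-dec
    (meet →-dec ((1 ≤? y + y′) ×-dec (¬? (y ≟ y′) →-dec ((3 ≤? x + x′) ×-dec (1 ≤? z + z′)))))

-- An interval representation of the graph on the eight pairs `x , z` given by these two
-- coordinates. Vertices with the same pair always meet here.
pathShape : ℕ → ℕ → Shape
pathShape 0 0 = span 4 4 ≤-refl
pathShape 0 _ = span 0 0 z≤n
pathShape 1 0 = span 3 3 ≤-refl
pathShape 1 _ = span 1 2 (s≤s z≤n)
pathShape 2 0 = span 2 2 ≤-refl
pathShape 2 _ = span 1 3 (s≤s z≤n)
pathShape _ 0 = span 0 1 z≤n
pathShape _ _ = span 0 4 z≤n

PathSpec : (x x′ z z′ : ℕ) → Set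
PathSpec x x′ z z′ =
  (3 ≤ x + x′ × 1 ≤ z + z′ → Meets (pathShape x z) (pathShape x′ z′)) ×
  (Meets (pathShape x z) (pathShape x′ z′) → ¬ (x ≡ x′ × z ≡ z′) → 3 ≤ x + x′ × 1 ≤ z + z′)

pathSpec : ∀ {x x′ z z′} → x ≤ 3 → x′ ≤ 3 → z ≤ 1 → z′ ≤ 1 → PathSpec x x′ z z′
pathSpec a b c d =
  from-yes (allUpTo? (λ x → allUpTo? (λ x′ → allUpTo? (λ z → allUpTo? (λ z′ →
            dec x x′ z z′) 2) 2) 4) 4)
    (s≤s a) (s≤s b) (s≤s c) (s≤s d)
  where
  dec : ∀ x x′ z z′ → Dec (PathSpec x x′ z z′)
  dec x x′ z z′ = let meet = meets? (pathShape x z) (pathShape x′ z′) in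
    (((3 ≤? x + x′) ×-dec (1 ≤? z + z′)) →-dec meet) ×-dec
    (meet →-dec (¬? ((x ≟ x′) ×-dec (z ≟ z′)) →-dec ((3 ≤? x + x′) ×-dec (1 ≤? z + z′))))

-- Again `z` gets no drawing. Ends that differ at a third coordinate are judged by its side drawing;
-- ends that agree at all of these differ at `i` or `z`, where the path drawing is exact.
box≤n-1-three : (m : Vec ℕ (suc n)) → ∀ i → lookup m i ≡ 3 → (∀ k → k ≢ i → lookup m k ≡ 1) →
  ∀ z → z ≢ i → IsIntersectionOfIntervalGraphs (D m) n
box≤n-1-three {n} m i mi≡3 m≡1 z z≢i = shapes⇒intersection m shape meet cov
  where
  shapeAt : ∀ k → Dec (k ≡ i) → Vertex m → Shape
  shapeAt k (yes _) v = pathShape (v at i) (v at z)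
  shapeAt k (no _)  v = sideShape (v at i) (v at k) (v at z)
  shape : Fin n → Vertex m → Shape
  shape j = shapeAt (punchIn z j) (punchIn z j Fin.≟ i)
  ≤3 : ∀ (v : Vertex m) → v at i ≤ 3
  ≤3 v = subst (v at i ≤_) mi≡3 (value≤ v i)
  ≤1 : ∀ (v : Vertex m) k → k ≢ i → v at k ≤ 1
  ≤1 v k k≢i = subst (v at k ≤_) (m≡1 k k≢i) (value≤ v k)
  path : ∀ (v w : Vertex m) → PathSpec (v at i) (w at i) (v at z) (w at z)
  path v w = pathSpec (≤3 v) (≤3 w) (≤1 v z z≢i) (≤1 w z z≢i)
  side : ∀ (v w : Vertex m) k → k ≢ i → SideSpec (v at i) (w at i) (v at k) (w at k) (v at z) (w at z)
  side v w k k≢i = sideSpec (≤3 v) (≤3 w) (≤1 v k k≢i) (≤1 w k k≢i) (≤1 v z z≢i) (≤1 w z z≢i)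
  cover₁ : ∀ {v w : Vertex m} → Adj (D m) v w → ∀ k → k ≢ i → 1 ≤ v at k + w at k
  cover₁ (_ , cover) k k≢i = subst (_≤ _) (m≡1 k k≢i) (cover k)
  cover₃ : ∀ {v w : Vertex m} → Adj (D m) v w → 3 ≤ v at i + w at i
  cover₃ (_ , cover) = subst (_≤ _) mi≡3 (cover i)
  meet : ∀ {v w} j → v ≢ w → Adj (D m) v w → Meets (shape j v) (shape j w)
  meet {v} {w} j _ vw with punchIn z j Fin.≟ i
  ... | yes _ = proj₁ (path v w) (cover₃ {v} {w} vw , cover₁ {v} {w} vw z z≢i)
  ... | no ≢i = proj₁ (side v w _ ≢i) (cover₃ {v} {w} vw , cover₁ {v} {w} vw _ ≢i , cover₁ {v} {w} vw z z≢i)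
  module _ {v w : Vertex m} (v≢w : v ≢ w) (ms : ∀ j → Meets (shape j v) (shape j w)) where
    meetAt : ∀ k → z ≢ k → Meets (shapeAt k (k Fin.≟ i) v) (shapeAt k (k Fin.≟ i) w)
    meetAt k z≢k = subst (λ k → Meets (shapeAt k (k Fin.≟ i) v) (shapeAt k (k Fin.≟ i) w))
                     (punchIn-punchOut z≢k) (ms (punchOut z≢k))
    meetPath : Meets (pathShape (v at i) (v at z)) (pathShape (w at i) (w at z))
    meetPath with i Fin.≟ i | meetAt i z≢i
    ... | yes _ | mt = mt
    ... | no ¬p | _  = ⊥-elim (¬p refl)
    meetSide : ∀ k → z ≢ k → k ≢ i →
      Meets (sideShape (v at i) (v at k) (v at z)) (sideShape (w at i) (w at k) (w at z))
    meetSide k z≢k k≢i with k Fin.≟ i | meetAt k z≢k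
    ... | yes k≡i | _  = ⊥-elim (k≢i k≡i)
    ... | no _    | mt = mt
    differ? : ∀ k → Dec (z ≢ k × k ≢ i × v at k ≢ w at k)
    differ? k = ¬? (z Fin.≟ k) ×-dec ¬? (k Fin.≟ i) ×-dec ¬? (v at k ≟ w at k)
    xz : 3 ≤ v at i + w at i × 1 ≤ v at z + w at z
    xz with any? differ?
    ... | yes (k , z≢k , k≢i , ne) = proj₂ (proj₂ (side v w k k≢i) (meetSide k z≢k k≢i)) ne
    ... | no same = proj₂ (path v w) meetPath λ (eqᵢ , eq₂) → v≢w (vertex-≗ (agree eqᵢ eq₂))
      where
      agree : v at i ≡ w at i → v at z ≡ w at z → ∀ k → v at k ≡ w at k
      agree eqᵢ eq₂ k with z Fin.≟ k | k Fin.≟ i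
      ... | yes refl | _        = eq₂
      ... | no _     | yes refl = eqᵢ
      ... | no z≢k   | no k≢i   = decidable-stable (_ ≟ _) λ ne → same (k , z≢k , k≢i , ne)
    cov : ∀ k → v at k + w at k ≥ lookup m k
    cov k with k Fin.≟ i | z Fin.≟ k
    ... | yes refl | _        = subst (_≤ _) (sym mi≡3) (proj₁ xz)
    ... | no k≢i   | yes refl = subst (_≤ _) (sym (m≡1 k k≢i)) (proj₂ xz)
    ... | no k≢i   | no z≢k   = subst (_≤ _) (sym (m≡1 k k≢i)) (proj₁ (proj₂ (side v w k k≢i) (meetSide k z≢k k≢i)))

-- The case m = (1,1)

value≢0 : {m : Vec ℕ n} (v : Vertex m) → value v ≢ replicate n 0
value≢0 (_ ⟨,⟩ irr[ p ]) = ¬-recompute (proj₁ (proj₂ p))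

value≢m : {m : Vec ℕ n} (v : Vertex m) → value v ≢ m
value≢m (_ ⟨,⟩ irr[ p ]) = ¬-recompute (proj₂ (proj₂ p))

-- Only (0,1) and (1,0) are vertices, and they cover each other: the graph is a single edge.
complement₁₁ : ∀ {a b c d} → a ≤ 1 → b ≤ 1 → c ≤ 1 → d ≤ 1 →
  ¬ (a ≡ 0 × b ≡ 0) → ¬ (a ≡ 1 × b ≡ 1) → ¬ (c ≡ 0 × d ≡ 0) → ¬ (c ≡ 1 × d ≡ 1) →
  ¬ (a ≡ c × b ≡ d) → 1 ≤ a + c × 1 ≤ b + d
complement₁₁ p q r s =
  from-yes (allUpTo? (λ a → allUpTo? (λ b → allUpTo? (λ c → allUpTo? (λ d →
      ¬? ((a ≟ 0) ×-dec (b ≟ 0)) →-dec ¬? ((a ≟ 1) ×-dec (b ≟ 1)) →-dec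
      ¬? ((c ≟ 0) ×-dec (d ≟ 0)) →-dec ¬? ((c ≟ 1) ×-dec (d ≟ 1)) →-dec
      ¬? ((a ≟ c) ×-dec (b ≟ d)) →-dec ((1 ≤? a + c) ×-dec (1 ≤? b + d))) 2) 2) 2) 2)
    (s≤s p) (s≤s q) (s≤s r) (s≤s s)

box-1-1 : (m : Vec ℕ n) → toList m ≡ 1 ∷ 1 ∷ [] → IsIntersectionOfIntervalGraphs (D m) 0
box-1-1 (.1 ∷ .1 ∷ []) refl = shapes⇒intersection _ (λ ()) (λ ()) λ v≢w _ i → cov _ _ v≢w i
  where
  both : ∀ {a b c d : ℕ} → a ≡ c × b ≡ d → a ∷ b ∷ [] ≡ c ∷ d ∷ []
  both (refl , refl) = refl
  cov : ∀ (v w : Vertex (1 ∷ 1 ∷ [])) → v ≢ w → ∀ i → v at i + w at i ≥ lookup (1 ∷ 1 ∷ []) i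
  cov v@((a ∷ b ∷ []) ⟨,⟩ _) w@((c ∷ d ∷ []) ⟨,⟩ _) v≢w i
    with complement₁₁ (value≤ v zero) (value≤ v (suc zero)) (value≤ w zero) (value≤ w (suc zero))
           (value≢0 v ∘ both) (value≢m v ∘ both) (value≢0 w ∘ both) (value≢m w ∘ both)
           (v≢w ∘ value-injective ∘ both)
  cov v w v≢w zero       | p , _ = p
  cov v w v≢w (suc zero) | _ , p = p

-- Lower bounds from conflicting non-edges

-- The vertex `m − u`. The first witness keeps it different from `m`, the second from zero.
co : (m : Vec ℕ n) (u : Fin n → ℕ) → ∃ (λ i → 1 ≤ u i × 1 ≤ lookup m i) →
  ∃ (λ i → u i < lookup m i) → Vertex m
co {n} m u (i , 1≤u , 1≤m) (j , u<m) = val ⟨,⟩ irr[ (λ k → subst (_≤ lookup m k) (sym (at k)) (m∸n≤m _ (u k))) , ≢0 , ≢m ]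
  where
  val : Vec ℕ n
  val = tabulate λ k → lookup m k ∸ u k
  at : ∀ k → lookup val k ≡ lookup m k ∸ u k
  at = lookup∘tabulate λ k → lookup m k ∸ u k
  ≢0 : val ≢ replicate n 0
  ≢0 eq = <⇒≢ (m<n⇒0<n∸m u<m) (trans (sym (trans (cong (λ v → lookup v j) eq) (lookup-replicate j 0))) (at j))
  ≢m : val ≢ m
  ≢m eq = <⇒≢ (∸-monoʳ-< 1≤u′ u≤m) (trans (sym at′) refl)
    where
    -- Subtraction is truncated, so what is really removed at `i` is the minimum of `u i` and
    -- `lookup m i`.
    1≤u′ : 0 < u i ⊓ lookup m i
    1≤u′ = ⊓-glb 1≤u 1≤m
    u≤m : u i ⊓ lookup m i ≤ lookup m i
    u≤m = m⊓n≤n (u i) _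
    at′ : lookup m i ≡ lookup m i ∸ u i ⊓ lookup m i
    at′ = trans (cong (λ v → lookup v i) (sym eq)) (trans (at i) (lem (lookup m i) (u i)))
      where
      lem : ∀ a b → a ∸ b ≡ a ∸ b ⊓ a
      lem a b with ≤-total b a
      ... | inj₁ b≤a = cong (a ∸_) (sym (m≤n⇒m⊓n≡m b≤a))
      ... | inj₂ a≤b = trans (m≤n⇒m∸n≡0 a≤b) (sym (trans (cong (a ∸_) (m≥n⇒m⊓n≡n a≤b)) (n∸n≡0 a)))

at-co : (m : Vec ℕ n) (u : Fin n → ℕ) → ∀ p q k → co m u p q at k ≡ lookup m k ∸ u k
at-co m u p q = lookup∘tabulate λ k → lookup m k ∸ u k

Covers : {m : Vec ℕ n} → Vertex m → Vertex m → Set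
Covers {m = m} v w = ∀ i → lookup m i ≤ v at i + w at i

_≟ᵛ_ : {m : Vec ℕ n} (v w : Vertex m) → Dec (v ≡ w)
v ≟ᵛ w = map′ value-injective (cong value) (≡-dec _≟_ (value v) (value w))

-- A non-edge with a common bound `env` on the complements of its two ends. If the bounds of two
-- gaps add up to at most `m`, then all four cross pairs cover.
record Gap (m : Vec ℕ n) : Set where
  field
    lft rgt : Vertex m
    env     : Fin n → ℕ
    lft-env : ∀ i → lookup m i ≤ lft at i + env i
    rgt-env : ∀ i → lookup m i ≤ rgt at i + env i
    lft≢rgt : lft ≢ rgt
    gap     : ∃ λ i → lft at i + rgt at i < lookup m i

open Gap

Conflict : {m : Vec ℕ n} → Gap m → Gap m → Set
Conflict {m = m} e f = ∀ i → env e i + env f i ≤ lookup m i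

conflict-sym : {m : Vec ℕ n} (e f : Gap m) → Conflict e f → Conflict f e
conflict-sym {m = m} e f ef i = subst (_≤ lookup m i) (+-comm (env e i) (env f i)) (ef i)

m≤m∸n+n : ∀ m n → m ≤ m ∸ n + n
m≤m∸n+n m n = ≤-trans (m≤n+m∸n m n) (≤-reflexive (+-comm n (m ∸ n)))

covers-env : ∀ {M} a b p q → M ≤ a + p → M ≤ b + q → p + q ≤ M → M ≤ a + b
covers-env {M} a b p q M≤a+p M≤b+q p+q≤M = +-cancelʳ-≤ M M (a + b) (begin
  M + M             ≤⟨ +-mono-≤ M≤a+p M≤b+q ⟩
  (a + p) + (b + q) ≡⟨ interchange +-commutativeSemigroup a p b q ⟩
  (a + b) + (p + q) ≤⟨ +-monoʳ-≤ (a + b) p+q≤M ⟩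
  (a + b) + M       ∎)
  where open ≤-Reasoning

∸-covers : ∀ {M} p q → p + q ≤ M → M ≤ M ∸ p + (M ∸ q)
∸-covers {M} p q = covers-env (M ∸ p) (M ∸ q) p q (m≤m∸n+n M p) (m≤m∸n+n M q)

-- Interval graphs as colours of gaps

module Orders {m : Vec ℕ n} {d : ℕ} (rep : IsIntersectionOfIntervalGraphs (D m) d) where

  private
    graph = proj₁ rep
    edges = proj₂ (proj₂ rep)

  module O (j : Fin d) = IntervalOrder (intervalOrder {G = graph j} (proj₁ (proj₂ rep) j))

  _⊏[_]_ : Vertex m → Fin d → Vertex m → Set
  v ⊏[ j ] w = O._⊏_ j v w

  -- Equal vertices are included, by irreflexivity, so cross pairs of gaps need not be checked for
  -- distinctness.
  covers⇒⋢ : ∀ {j v w} → Covers v w → ¬ v ⊏[ j ] w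
  covers⇒⋢ {j} {v} {w} cov with v ≟ᵛ w
  ... | yes refl = O.⊏-irr j
  ... | no v≢w   = O.⊏-apart j v≢w (to (edges v w v≢w) (v≢w , cov) j)

  -- Otherwise `v` and `w` would be adjacent in each of the finitely many interval graphs, hence in
  -- `D m`, against the uncovered coordinate.
  separated : ∀ {v w} → v ≢ w → ∃ (λ i → v at i + w at i < lookup m i) →
    ¬ ¬ ∃ λ j → v ⊏[ j ] w ⊎ w ⊏[ j ] v
  separated {v} {w} v≢w (i , lt) k = ¬¬-choice adj
    λ all → <⇒≱ lt (proj₂ (from (edges v w v≢w) all) i)
    where
    adj : ∀ j → ¬ ¬ Adj (graph j) v w
    adj j ¬vw = O.⊏-cover j v≢w ¬vw λ s → k (j , s)

  Colour : Gap m → Set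
  Colour e = ∃ λ j → lft e ⊏[ j ] rgt e ⊎ rgt e ⊏[ j ] lft e

  colour : ∀ e → ¬ ¬ Colour e
  colour e = separated (lft≢rgt e) (gap e)

  private
    clash : ∀ {j a b c d} → a ⊏[ j ] b → c ⊏[ j ] d → Covers a d → Covers c b → ⊥
    clash {j} {a} {b} {c} {d} a⊏b c⊏d ad cb = O.ferrers j a⊏b c⊏d [ covers⇒⋢ {j} {a} {d} ad , covers⇒⋢ {j} {c} {b} cb ]′

  -- The complement of a conflicting pair contains 2K₂, that is, the graph
  -- contains an induced four-cycle with the two gaps as its diagonals.
  conflict⇒≢ : ∀ {e f} → Conflict e f → (c : Colour e) (c′ : Colour f) → proj₁ c ≢ proj₁ c′
  conflict⇒≢ {e} {f} ef (j , s) (.j , t) refl = go s t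
    where
    ll : Covers (lft e) (lft f)
    ll i = covers-env (lft e at i) (lft f at i) (env e i) (env f i) (lft-env e i) (lft-env f i) (ef i)
    lr : Covers (lft e) (rgt f)
    lr i = covers-env (lft e at i) (rgt f at i) (env e i) (env f i) (lft-env e i) (rgt-env f i) (ef i)
    rl : Covers (rgt e) (lft f)
    rl i = covers-env (rgt e at i) (lft f at i) (env e i) (env f i) (rgt-env e i) (lft-env f i) (ef i)
    rr : Covers (rgt e) (rgt f)
    rr i = covers-env (rgt e at i) (rgt f at i) (env e i) (env f i) (rgt-env e i) (rgt-env f i) (ef i)
    swap : ∀ {v w : Vertex m} → Covers v w → Covers w v
    swap {v} {w} c i = subst (lookup m i ≤_) (+-comm (v at i) (w at i)) (c i)
    go : lft e ⊏[ j ] rgt e ⊎ rgt e ⊏[ j ] lft e → lft f ⊏[ j ] rgt f ⊎ rgt f ⊏[ j ] lft f → ⊥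
    go (inj₁ p) (inj₁ q) = clash p q lr (swap {rgt e} {lft f} rl)
    go (inj₁ p) (inj₂ q) = clash p q ll (swap {rgt e} {rgt f} rr)
    go (inj₂ p) (inj₁ q) = clash p q rr (swap {lft e} {lft f} ll)
    go (inj₂ p) (inj₂ q) = clash p q rl (swap {lft e} {rgt f} lr)

  -- Conflicting gaps have different colours, so fewer than `k` colours contradict the pigeonhole
  -- principle.
  clique≤ : ∀ {k} (e : Fin k → Gap m) → (∀ {x y} → x ≢ y → Conflict (e x) (e y)) → k ≤ d
  clique≤ {k} e conf = ≮⇒≥ λ d<k → ¬¬-choice (colour ∘ e) λ col →
    let x , y , x<y , eq = pigeonhole d<k (proj₁ ∘ col)
    in conflict⇒≢ {e x} {e y} (conf (Fin.<⇒≢ x<y)) (col x) (col y) eq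

  -- The clique takes `k` colours, none of them that of `a` or `b`. Fewer than `2 + k` colours leave
  -- at most one for both.
  twins : ∀ {k} {a b} (ca : Colour a) (cb : Colour b) (e : Fin k → Gap m) →
    (∀ x → Conflict a (e x)) → (∀ x → Conflict b (e x)) →
    (∀ {x y} → x ≢ y → Conflict (e x) (e y)) → d < 2 + k → ¬ ¬ proj₁ ca ≡ proj₁ cb
  twins {k} {a} {b} ca cb e conf-a conf-b conf d<k ca≢cb = ¬¬-choice (colour ∘ e) λ col →
    let x , y , x<y , eq = pigeonhole d<k (f col) in differ col x y x<y eq
    where
    f : (∀ x → Colour (e x)) → Fin (2 + k) → Fin d
    f col zero          = proj₁ ca
    f col (suc zero)    = proj₁ cb
    f col (suc (suc x)) = proj₁ (col x)
    differ : ∀ col x y → x Fin.< y → f col x ≢ f col y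
    differ col zero          (suc zero)    _ = ca≢cb
    differ col zero          (suc (suc y)) _ = conflict⇒≢ {a} {e y} (conf-a y) ca (col y)
    differ col (suc zero)    (suc (suc y)) _ = conflict⇒≢ {b} {e y} (conf-b y) cb (col y)
    differ col (suc (suc x)) (suc (suc y)) x<y =
      conflict⇒≢ {e x} {e y} (conf λ { refl → <-irrefl refl x<y }) (col x) (col y)
    differ col (suc zero)    (suc zero)    (s≤s ())
    differ col (suc (suc x)) (suc zero)    (s≤s ())

-- Gaps supported on two coordinates

spike : (c : Fin n) (b : ℕ) (t : Fin n) (s : ℕ) → Fin n → ℕ
spike c b t s k with c Fin.≟ k | t Fin.≟ k
... | yes _ | _     = b
... | no _  | yes _ = s
... | no _  | no _  = 0

spike-c : ∀ (c : Fin n) b t s → spike c b t s c ≡ b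
spike-c c b t s with c Fin.≟ c
... | yes _  = refl
... | no c≢c = ⊥-elim (c≢c refl)

spike-t : ∀ {c t : Fin n} b s → c ≢ t → spike c b t s t ≡ s
spike-t {c = c} {t} b s c≢t with c Fin.≟ t | t Fin.≟ t
... | yes c≡t | _      = ⊥-elim (c≢t c≡t)
... | no _    | yes _  = refl
... | no _    | no t≢t = ⊥-elim (t≢t refl)

spike-mono : ∀ (c : Fin n) {a b} t {s} → a ≤ b → ∀ k → spike c a t 0 k ≤ spike c b t s k
spike-mono c t a≤b k with c Fin.≟ k | t Fin.≟ k
... | yes _ | _     = a≤b
... | no _  | yes _ = z≤n
... | no _  | no _  = z≤n

-- The pair m − a e_c, m − b e_c − s e_t, not covering coordinate c.
spikeGap : (m : Vec ℕ n) (c t : Fin n) (a b s : ℕ) → c ≢ t → 1 ≤ a → a ≤ b → b ≤ lookup m c →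
  lookup m c < a + b → s < lookup m t → a ≢ b ⊎ 1 ≤ s → Gap m
spikeGap {n} m c t a b s c≢t 1≤a a≤b b≤m m<a+b s<m dist = record
  { lft = co m u lc lt ; rgt = co m v rc rt ; env = v
  ; lft-env = λ i → subst (λ x → lookup m i ≤ x + v i) (sym (at-co m u lc lt i))
      (≤-trans (m≤m∸n+n (lookup m i) (u i)) (+-monoʳ-≤ (lookup m i ∸ u i) (spike-mono c t a≤b i)))
  ; rgt-env = λ i → subst (λ x → lookup m i ≤ x + v i) (sym (at-co m v rc rt i))
      (m≤m∸n+n (lookup m i) (v i))
  ; lft≢rgt = λ eq → [ (λ a≢b → a≢b (at-c eq)) , (λ 1≤s → <⇒≢ 1≤s (at-t eq)) ]′ dist
  ; gap = c , subst₂ (λ x y → x + y < lookup m c) (sym lft-c) (sym rgt-c) low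
  }
  where
  u v : Fin n → ℕ
  u = spike c a t 0
  v = spike c b t s
  1≤m : 1 ≤ lookup m c
  1≤m = ≤-trans 1≤a (≤-trans a≤b b≤m)
  lc = c , subst (1 ≤_) (sym (spike-c c a t 0)) 1≤a , 1≤m
  rc = c , subst (1 ≤_) (sym (spike-c c b t s)) (≤-trans 1≤a a≤b) , 1≤m
  lt = t , subst (_< lookup m t) (sym (spike-t a 0 c≢t)) (≤-<-trans z≤n s<m)
  rt = t , subst (_< lookup m t) (sym (spike-t b s c≢t)) s<m
  lft-c : co m u lc lt at c ≡ lookup m c ∸ a
  lft-c = trans (at-co m u lc lt c) (cong (lookup m c ∸_) (spike-c c a t 0))
  rgt-c : co m v rc rt at c ≡ lookup m c ∸ b
  rgt-c = trans (at-co m v rc rt c) (cong (lookup m c ∸_) (spike-c c b t s))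
  lft-t : co m u lc lt at t ≡ lookup m t ∸ 0
  lft-t = trans (at-co m u lc lt t) (cong (lookup m t ∸_) (spike-t a 0 c≢t))
  rgt-t : co m v rc rt at t ≡ lookup m t ∸ s
  rgt-t = trans (at-co m v rc rt t) (cong (lookup m t ∸_) (spike-t b s c≢t))
  at-c : co m u lc lt ≡ co m v rc rt → a ≡ b
  at-c eq = ∸-cancelˡ-≡ (≤-trans a≤b b≤m) b≤m (trans (sym lft-c) (trans (cong (_at c) eq) rgt-c))
  at-t : co m u lc lt ≡ co m v rc rt → 0 ≡ s
  at-t eq = ∸-cancelˡ-≡ z≤n (<⇒≤ s<m) (trans (sym lft-t) (trans (cong (_at t) eq) rgt-t))
  low : lookup m c ∸ a + (lookup m c ∸ b) < lookup m c
  low = begin-strict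
    lookup m c ∸ a + (lookup m c ∸ b) <⟨ +-monoʳ-< (lookup m c ∸ a) below ⟩
    lookup m c ∸ a + a                ≡⟨ m∸n+n≡m (≤-trans a≤b b≤m) ⟩
    lookup m c                        ∎
    where
    open ≤-Reasoning
    below : lookup m c ∸ b < a
    below = subst (lookup m c ∸ b <_) (m+n∸n≡m a b) (∸-monoˡ-< m<a+b b≤m)

-- As `c ≢ c′`, two nonzero entries can coincide in three ways only, one for each of the last three
-- hypotheses.
spike-conflict : (m : Vec ℕ n) {c c′ t t′ : Fin n} {b b′ s s′ : ℕ} → c ≢ c′ →
  b ≤ lookup m c → b′ ≤ lookup m c′ → s ≤ lookup m t → s′ ≤ lookup m t′ →
  (c ≡ t′ → b + s′ ≤ lookup m c) → (c′ ≡ t → b′ + s ≤ lookup m c′) → (t ≡ t′ → s + s′ ≤ lookup m t) →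
  ∀ k → spike c b t s k + spike c′ b′ t′ s′ k ≤ lookup m k
spike-conflict m {c} {c′} {t} {t′} {b} {b′} {s} {s′} c≢c′ b≤ b′≤ s≤ s′≤ h₁ h₂ h₃ k
  with c Fin.≟ k | t Fin.≟ k | c′ Fin.≟ k | t′ Fin.≟ k
... | yes refl | _        | yes refl | _        = ⊥-elim (c≢c′ refl)
... | yes refl | _        | no _     | yes refl = h₁ refl
... | yes refl | _        | no _     | no _     = subst (_≤ lookup m k) (sym (+-identityʳ b)) b≤
... | no _     | yes refl | yes refl | _        = subst (_≤ lookup m k) (+-comm b′ s) (h₂ refl)
... | no _     | yes refl | no _     | yes refl = h₃ refl
... | no _     | yes refl | no _     | no _     = subst (_≤ lookup m k) (sym (+-identityʳ s)) s≤
... | no _     | no _     | yes refl | _        = b′≤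
... | no _     | no _     | no _     | yes refl = s′≤
... | no _     | no _     | no _     | no _     = z≤n

module _ (m : Vec ℕ n) (m≥1 : ∀ i → 1 ≤ lookup m i) where

  -- Both ends vanish at `c`, and the unit at `t` tells them apart. Two such gaps with the same `t`
  -- use 2 there, which `2 ≤ lookup m t` permits.
  fullGap : ∀ c t → c ≢ t → 2 ≤ lookup m t → Gap m
  fullGap c t c≢t 2≤mt = spikeGap m c t (lookup m c) (lookup m c) 1 c≢t (m≥1 c) ≤-refl ≤-refl
    (m<m+n _ (m≥1 c)) 2≤mt (inj₂ ≤-refl)

  fullGap-conflict : ∀ {c c′ t} c≢t c′≢t 2≤mt → c ≢ c′ →
    Conflict (fullGap c t c≢t 2≤mt) (fullGap c′ t c′≢t 2≤mt)
  fullGap-conflict {c} {c′} {t} c≢t c′≢t 2≤mt c≢c′ =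
    spike-conflict m c≢c′ ≤-refl ≤-refl (m≥1 t) (m≥1 t) (⊥-elim ∘ c≢t) (⊥-elim ∘ c′≢t) (λ _ → 2≤mt)

module _ (m : Vec ℕ (suc n)) (m≥1 : ∀ i → 1 ≤ lookup m i) where

  private
    Q : ∀ t → 2 ≤ lookup m t → Fin n → Gap m
    Q t 2≤mt x = fullGap m m≥1 (punchIn t x) t (punchInᵢ≢i t x) 2≤mt
    Q-conflict : ∀ t 2≤mt {x y} → x ≢ y → Conflict (Q t 2≤mt x) (Q t 2≤mt y)
    Q-conflict t 2≤mt {x} {y} x≢y = fullGap-conflict m m≥1 (punchInᵢ≢i t x) (punchInᵢ≢i t y) 2≤mt
      (x≢y ∘ punchIn-injective t x y)

  n-1≤box : ∀ {d} → ∀ t → 2 ≤ lookup m t → IsIntersectionOfIntervalGraphs (D m) d → n ≤ d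
  n-1≤box t 2≤mt rep = Orders.clique≤ rep (Q t 2≤mt) (Q-conflict t 2≤mt)

  -- The `n` full gaps with unit at `i` are joined by `S`, with complements 2 e_i and (m_i - 1) e_i.
  -- They add up to more than m_i, differ because m_i ≥ 4, and leave room for the unit at `i`.
  n≤box-four : ∀ {d} → ∀ i → 4 ≤ lookup m i → ∀ o → i ≢ o → IsIntersectionOfIntervalGraphs (D m) d → suc n ≤ d
  n≤box-four i 4≤mi o i≢o rep = Orders.clique≤ rep e conf
    where
    2≤mi : 2 ≤ lookup m i
    2≤mi = ≤-trans (s≤s (s≤s z≤n)) 4≤mi
    b = lookup m i ∸ 1
    3≤b : 3 ≤ b
    3≤b = ∸-monoˡ-≤ 1 4≤mi
    b+1 : b + 1 ≡ lookup m i
    b+1 = m∸n+n≡m (m≥1 i)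
    S : Gap m
    S = spikeGap m i o 2 b 0 i≢o (s≤s z≤n) (<⇒≤ 3≤b) (m∸n≤m _ 1)
          (subst (_< 2 + b) b+1 (subst (b + 1 <_) (+-comm b 2) (+-monoʳ-< b (n<1+n 1))))
          (m≥1 o) (inj₁ (<⇒≢ 3≤b))
    S-conflict : ∀ x → Conflict S (Q i 2≤mi x)
    S-conflict x = spike-conflict m (punchInᵢ≢i i x ∘ sym) (m∸n≤m _ 1) ≤-refl z≤n (m≥1 i)
      (λ _ → ≤-reflexive b+1) (λ _ → ≤-reflexive (+-identityʳ _)) (⊥-elim ∘ i≢o ∘ sym)
    e : Fin (suc n) → Gap m
    e zero    = S
    e (suc x) = Q i 2≤mi x
    conf : ∀ {x y} → x ≢ y → Conflict (e x) (e y)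
    conf {zero}  {zero}  x≢y = ⊥-elim (x≢y refl)
    conf {zero}  {suc y} _   = S-conflict y
    conf {suc x} {zero}  _   = conflict-sym S (Q i 2≤mi x) (S-conflict x)
    conf {suc x} {suc y} x≢y = Q-conflict i 2≤mi (x≢y ∘ cong suc)

-- The complements e_x and 2 e_x add up to 3 > 2 at `x`, and the gaps of different coordinates have
-- disjoint supports.
n≤box-twos : (m : Vec ℕ (2 + n)) → (∀ i → lookup m i ≡ 2) → ∀ {d} →
  IsIntersectionOfIntervalGraphs (D m) d → 2 + n ≤ d
n≤box-twos {n} m m≡2 rep = Orders.clique≤ rep e λ {x} {y} x≢y →
    spike-conflict m x≢y (≤2 x) (≤2 y) z≤n z≤n
      (λ _ → ≤2 x) (λ _ → ≤2 y) (λ _ → z≤n)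
  where
  ≤2 : ∀ x → 2 ≤ lookup m x
  ≤2 x = ≤-reflexive (sym (m≡2 x))
  e : Fin (2 + n) → Gap m
  e x = spikeGap m x (punchIn x zero) 1 2 0 (punchInᵢ≢i x zero ∘ sym) ≤-refl (s≤s z≤n) (≤2 x)
          (s≤s (≤-reflexive (m≡2 x))) (<⇒≤ (≤2 _)) (inj₁ λ ())

-- No single clique of gaps is large enough here; the two families of full gaps
-- force P and R, resp. P and P′, into the same interval graph, although P′ and
-- R conflict.
n≤box-three : (m : Vec ℕ (2 + n)) → (∀ i → 1 ≤ lookup m i) → ∀ i j → i ≢ j →
  lookup m i ≡ 3 → 2 ≤ lookup m j → ∀ {d} → IsIntersectionOfIntervalGraphs (D m) d → 2 + n ≤ d
n≤box-three {n} m m≥1 i j i≢j mi≡3 2≤mj {d} rep = ≮⇒≥ λ d<n →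
  (colour P >>= λ cP → colour P′ >>= λ cP′ → colour R >>= λ cR →
   twins {a = P} {b = R} cP cR (Q i 2≤mi (proj₁ ∘ off)) P-Qi R-Qi (Q-conflict i 2≤mi (proj₁ ∘ off)) d<n >>= λ P≡R →
   twins {a = P} {b = P′} cP cP′ (Q j 2≤mj (proj₂ ∘ off)) P-Qj P′-Qj (Q-conflict j 2≤mj (proj₂ ∘ off)) d<n >>= λ P≡P′ →
   λ _ → conflict⇒≢ {P′} {R} P′-R cP′ cR (trans (sym P≡P′) P≡R)) id
  where
  open Orders rep
  3≤mi : 3 ≤ lookup m i
  3≤mi = ≤-reflexive (sym mi≡3)
  mi≤3 : lookup m i ≤ 3
  mi≤3 = ≤-reflexive mi≡3
  2≤mi : 2 ≤ lookup m i
  2≤mi = <⇒≤ 3≤mi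
  P P′ R : Gap m
  -- In complements, `P` is 2 e_i, 2 e_i + e_j; `P′` is 2 e_i, 3 e_i; `R` is e_j, m_j e_j. `P`
  -- leaves a unit free at both `i` and `j`, `P′` only at `j`, and `R` only at `i`.
  P  = spikeGap m i j 2 2 1 i≢j (s≤s z≤n) ≤-refl 2≤mi (s≤s mi≤3) 2≤mj (inj₂ ≤-refl)
  P′ = spikeGap m i j 2 3 0 i≢j (s≤s z≤n) (n≤1+n 2) 3≤mi (s≤s (≤-trans mi≤3 (n≤1+n 3))) (m≥1 j) (inj₁ λ ())
  R  = spikeGap m j i 1 (lookup m j) 0 (i≢j ∘ sym) ≤-refl (m≥1 j) ≤-refl (n<1+n _) (m≥1 i) (inj₁ (<⇒≢ 2≤mj))
  -- `r` enumerates the coordinates other than `i` and `j`.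
  r : Fin n → Fin (2 + n)
  r x = punchIn i (punchIn (punchOut i≢j) x)
  off : ∀ x → r x ≢ i × r x ≢ j
  off x = punchInᵢ≢i i _ , λ eq → punchInᵢ≢i (punchOut i≢j) x
            (punchIn-injective i _ _ (trans eq (sym (punchIn-punchOut i≢j))))
  Q : ∀ t → 2 ≤ lookup m t → (∀ x → r x ≢ t) → Fin n → Gap m
  Q t 2≤mt ≢t x = fullGap m m≥1 (r x) t (≢t x) 2≤mt
  Q-conflict : ∀ t 2≤mt ≢t {x y} → x ≢ y → Conflict (Q t 2≤mt ≢t x) (Q t 2≤mt ≢t y)
  Q-conflict t 2≤mt ≢t {x} {y} x≢y = fullGap-conflict m m≥1 (≢t x) (≢t y) 2≤mt
    (x≢y ∘ punchIn-injective _ x y ∘ punchIn-injective i _ _)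
  P-Qi : ∀ x → Conflict P (Q i 2≤mi (proj₁ ∘ off) x)
  P-Qi x = spike-conflict m (proj₁ (off x) ∘ sym) 2≤mi ≤-refl (m≥1 j) (m≥1 i)
    (λ _ → 3≤mi) (⊥-elim ∘ proj₂ (off x)) (⊥-elim ∘ i≢j ∘ sym)
  P-Qj : ∀ x → Conflict P (Q j 2≤mj (proj₂ ∘ off) x)
  P-Qj x = spike-conflict m (proj₁ (off x) ∘ sym) 2≤mi ≤-refl (m≥1 j) (m≥1 j)
    (⊥-elim ∘ i≢j) (⊥-elim ∘ proj₂ (off x)) (λ _ → 2≤mj)
  P′-Qj : ∀ x → Conflict P′ (Q j 2≤mj (proj₂ ∘ off) x)
  P′-Qj x = spike-conflict m (proj₁ (off x) ∘ sym) 3≤mi ≤-refl z≤n (m≥1 j)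
    (⊥-elim ∘ i≢j) (⊥-elim ∘ proj₂ (off x)) (λ _ → m≥1 j)
  R-Qi : ∀ x → Conflict R (Q i 2≤mi (proj₁ ∘ off) x)
  R-Qi x = spike-conflict m (proj₂ (off x) ∘ sym) ≤-refl ≤-refl z≤n (m≥1 i)
    (⊥-elim ∘ i≢j ∘ sym) (⊥-elim ∘ proj₁ (off x)) (λ _ → m≥1 i)
  P′-R : Conflict P′ R
  P′-R = spike-conflict m i≢j 3≤mi ≤-refl z≤n z≤n
    (λ _ → 3≤mi) (λ _ → ≤-reflexive (+-identityʳ _)) (⊥-elim ∘ i≢j ∘ sym)

-- Lower bound for m = (1,…,1)

length-union : ∀ {A : Set} {B} d (L : Fin d → List A) → (∀ j → length (L j) ≤ B) →
  ∃ λ U → length U ≤ d * B × (∀ j {x} → x ∈ L j → x ∈ U)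
length-union zero    L _ = [] , z≤n , λ ()
length-union {B = B} (suc d) L bound =
  let U , U≤ , sub = length-union d (L ∘ suc) (bound ∘ suc) in
  L zero ++ U , subst (_≤ B + d * B) (sym (length-++ (L zero))) (+-mono-≤ (bound zero) U≤) ,
  λ { zero x∈ → ∈-++⁺ˡ x∈ ; (suc j) x∈ → ∈-++⁺ʳ (L zero) (sub j x∈) }

all-pairs≤ : (L : List (Fin n × Fin n)) → (∀ i k → (i , k) ∈ L) → n * n ≤ length L
all-pairs≤ {n} L mem = injective⇒≤ {f = f} inj
  where
  f : Fin (n * n) → Fin (length L)
  f t = index (mem (proj₁ (remQuot n t)) (proj₂ (remQuot {n} n t)))
  inj : ∀ {s t} → f s ≡ f t → s ≡ t
  inj {s} {t} eq = begin
    s                                     ≡⟨ combine-remQuot {n} n s ⟨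
    combine (proj₁ (rq s)) (proj₂ (rq s)) ≡⟨ cong (λ (a , b) → combine a b) same ⟩
    combine (proj₁ (rq t)) (proj₂ (rq t)) ≡⟨ combine-remQuot {n} n t ⟩
    t                                     ∎
    where
    open ≡-Reasoning
    rq = remQuot {n} n
    same : rq s ≡ rq t
    same = trans (lookup-index (mem _ _)) (trans (cong (List.lookup L) eq) (sym (lookup-index (mem _ _))))

-- The trace of one interval order: `E i k` will say that m - e_i lies on a fixed side of m - e_i -
-- e_k. The laws come from the Ferrers property.
record HalfCover (E : Rel (Fin n) 0ℓ) : Set where
  field
    loopless : ∀ {i} → ¬ E i i
    linked   : ∀ {i k i′ k′} → E i k → E i′ k′ → i ≢ i′ → i ≢ k′ → i′ ≢ k → ⊥
    acyclic  : ∀ {a b c} → E a b → E b c → E c a → ⊥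

-- By `linked`, of two arcs with different tails one ends where the other begins. Directed triangles
-- being excluded, what remains is an out-star at `a` with at most one arc into `a`.
star-shaped : {E : Rel (Fin (suc n)) 0ℓ} → Decidable E → HalfCover E →
  ∃₂ λ a a′ → ∀ {x y} → E x y → x ≡ a ⊎ x ≡ a′ × y ≡ a
star-shaped {n} {E} E? half with any? (λ i → any? (E? i))
... | no none = zero , zero , λ e → ⊥-elim (none (_ , _ , e))
... | yes (i , k , ik) = center (any? λ l → ¬? (l Fin.≟ i) ×-dec E? k l)
  where
  open HalfCover half
  -- Once every arc not leaving `a` enters `a`, two such arcs with different tails would violate
  -- `linked`.
  finish : ∀ a → (∀ {x y} → E x y → x ≢ a → y ≡ a) → ∃₂ λ a a′ → ∀ {x y} → E x y → x ≡ a ⊎ x ≡ a′ × y ≡ a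
  finish a at-a with any? (λ x → E? x a)
  ... | no none = a , a , λ {x} e → case-a e (x Fin.≟ a)
    where
    case-a : ∀ {x y} → E x y → Dec (x ≡ a) → x ≡ a ⊎ x ≡ a × y ≡ a
    case-a e (yes p) = inj₁ p
    case-a e (no ¬p) with at-a e ¬p
    ... | refl = ⊥-elim (none (_ , e))
  ... | yes (a′ , a′a) = a , a′ , λ {x} e → case-a e (x Fin.≟ a) (x Fin.≟ a′)
    where
    case-a : ∀ {x y} → E x y → Dec (x ≡ a) → Dec (x ≡ a′) → x ≡ a ⊎ x ≡ a′ × y ≡ a
    case-a e (yes p) _        = inj₁ p
    case-a e (no ¬p) (yes q)  = inj₂ (q , at-a e ¬p)
    case-a e (no ¬p) (no ¬q) with at-a e ¬p
    ... | refl = ⊥-elim (linked e a′a ¬q ¬p λ { refl → loopless a′a })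
  center : Dec (∃ λ l → l ≢ i × E k l) → ∃₂ λ a a′ → ∀ {x y} → E x y → x ≡ a ⊎ x ≡ a′ × y ≡ a
  center (yes (l , l≢i , kl)) = finish k λ e x≢k → decidable-stable (_ Fin.≟ _) (at-k e x≢k)
    where
    at-k : ∀ {x y} → E x y → x ≢ k → ¬ y ≢ k
    at-k {x} {y} e x≢k y≢k with x Fin.≟ l
    ... | no x≢l = linked e kl x≢k x≢l (y≢k ∘ sym)
    ... | yes refl with y Fin.≟ i
    ...   | yes refl = acyclic e ik kl
    ...   | no y≢i   = linked e ik l≢i x≢k (y≢i ∘ sym)
  center (no none) = finish i λ e x≢i → decidable-stable (_ Fin.≟ _) (at-i e x≢i)
    where
    at-i : ∀ {x y} → E x y → x ≢ i → ¬ y ≢ i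
    at-i {x} {y} e x≢i y≢i with x Fin.≟ k
    ... | yes refl = none (y , y≢i , e)
    ... | no x≢k   = linked e ik x≢i x≢k (y≢i ∘ sym)

star : Fin (suc n) → List (Fin (suc n) × Fin (suc n))
star {n} a = map (λ k → a , punchIn a k) (allFin n)

length-star : (a : Fin (suc n)) → length (star a) ≡ n
length-star {n} a = trans (length-map _ (allFin n)) (length-tabulate {n = n} id)

∈-star : ∀ (a : Fin (suc n)) {y} → a ≢ y → (a , y) ∈ star a
∈-star a a≢y = subst (λ y → (a , y) ∈ star a) (punchIn-punchOut a≢y) (∈-map⁺ _ (∈-allFin (punchOut a≢y)))

record Crossing (E F : Rel (Fin n) 0ℓ) : Set where
  field
    meeting  : ∀ {i k i′ k′} → E i k → F i′ k′ → i ≢ i′ → i ≢ k′ → k ≢ i′ → k ≢ k′ → ⊥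
    distinct : ∀ {i k} → E i k → ¬ F i k
    reversed : ∀ {i k} → E i k → ¬ F k i

-- Every arc touches its centre `a` or `b`. If the centres agree, or one relation only joins the two
-- centres, one out-star and two more pairs suffice. Otherwise `meeting` confines all arcs to a
-- triangle `a`, `b`, `k`, and five of its pairs suffice.
few-pairs : {E F : Rel (Fin (suc n)) 0ℓ} → Decidable E → Decidable F →
  HalfCover E → HalfCover F → Crossing E F →
  ∃ λ L → length L ≤ (2 + n) ⊔ 5 × (∀ {x y} → E x y ⊎ F x y → (x , y) ∈ L)
few-pairs {n} {E} {F} E? F? halfE halfF cross
  with star-shaped E? halfE | star-shaped F? halfF
... | a , a′ , starE | b , b′ , starF = by-centers (a Fin.≟ b)
  where
  open Crossing cross
  module E = HalfCover halfE
  module F = HalfCover halfF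
  Goal = ∃ λ L → length L ≤ (2 + n) ⊔ 5 × (∀ {x y} → E x y ⊎ F x y → (x , y) ∈ L)
  Ê F̂ : Rel (Fin (suc n)) 0ℓ
  Ê x y = E x y ⊎ E y x
  F̂ x y = F x y ⊎ F y x
  meetinĝ : ∀ {i k i′ k′} → Ê i k → F̂ i′ k′ → i ≢ i′ → i ≢ k′ → k ≢ i′ → k ≢ k′ → ⊥
  meetinĝ (inj₁ e) (inj₁ f) p q r s = meeting e f p q r s
  meetinĝ (inj₁ e) (inj₂ f) p q r s = meeting e f q p s r
  meetinĝ (inj₂ e) (inj₁ f) p q r s = meeting e f r s p q
  meetinĝ (inj₂ e) (inj₂ f) p q r s = meeting e f s r q p
  distinct̂ : ∀ {i k} → Ê i k → F̂ i k → ⊥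
  distinct̂ (inj₁ e) (inj₁ f) = distinct e f
  distinct̂ (inj₁ e) (inj₂ f) = reversed e f
  distinct̂ (inj₂ e) (inj₁ f) = reversed e f
  distinct̂ (inj₂ e) (inj₂ f) = distinct e f
  withStar : ∀ c p q → (∀ {x y} → E x y ⊎ F x y → (x ≡ c × c ≢ y) ⊎ (x , y) ≡ p ⊎ (x , y) ≡ q) → Goal
  withStar c p q mem = p ∷ q ∷ star c ,
    m≤n⇒m≤n⊔o 5 (s≤s (s≤s (≤-reflexive (length-star c)))) , λ e → place (mem e)
    where
    place : ∀ {x y} → (x ≡ c × c ≢ y) ⊎ (x , y) ≡ p ⊎ (x , y) ≡ q → (x , y) ∈ p ∷ q ∷ star c
    place (inj₁ (refl , c≢y)) = there (there (∈-star c c≢y))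
    place (inj₂ (inj₁ refl))  = here refl
    place (inj₂ (inj₂ refl))  = there (here refl)
  outE : ∀ {x y} → E x y → x ≢ y
  outE e refl = E.loopless e
  outF : ∀ {x y} → F x y → x ≢ y
  outF f refl = F.loopless f
  K? : Dec (∃ λ k → k ≢ b × Ê a k)
  K? = any? λ k → ¬? (k Fin.≟ b) ×-dec (E? a k ⊎-dec E? k a)
  L? : Dec (∃ λ l → l ≢ a × F̂ b l)
  L? = any? λ l → ¬? (l Fin.≟ a) ×-dec (F? b l ⊎-dec F? l b)

  module Triangle (a≢b : a ≢ b) {k l} (k≢b : k ≢ b) (ak : Ê a k) (l≢a : l ≢ a) (bl : F̂ b l) where
    to-l : ∀ {y} → Ê a y → y ≢ b → y ≡ l
    to-l ay y≢b = decidable-stable (_ Fin.≟ _) λ y≢l → meetinĝ ay bl a≢b (l≢a ∘ sym) y≢b y≢l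
    k≡l : k ≡ l
    k≡l = to-l ak k≢b
    to-k : ∀ {y} → F̂ b y → y ≢ a → y ≡ k
    to-k by y≢a = decidable-stable (_ Fin.≟ _) λ y≢k →
      meetinĝ ak by a≢b (y≢a ∘ sym) k≢b (y≢k ∘ sym)

    with-ab : Ê a b → Goal
    -- `F` has no arc between `a` and `b` now, and the only arc of `E` into `a` comes from `a′`.
    with-ab ab = (b , k) ∷ (k , b) ∷ (a , b) ∷ (a , k) ∷ (a′ , a) ∷ [] , m≤n⊔m (2 + n) 5 ,
      [ memE , memF ]′
      where
      L = (b , k) ∷ (k , b) ∷ (a , b) ∷ (a , k) ∷ (a′ , a) ∷ []
      ≢a : ∀ {y} → F̂ b y → y ≢ a
      ≢a by refl = distinct̂ ab (Sum.swap by)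
      memE : ∀ {x y} → E x y → (x , y) ∈ L
      memE {x} {y} e with starE e
      ... | inj₂ (refl , refl) = there (there (there (there (here refl))))
      ... | inj₁ refl with y Fin.≟ b
      ...   | yes refl = there (there (here refl))
      ...   | no y≢b   = there (there (there (here (cong (a ,_) (trans (to-l (inj₁ e) y≢b) (sym k≡l))))))
      memF : ∀ {x y} → F x y → (x , y) ∈ L
      memF {x} {y} f with starF f
      ... | inj₁ refl          = here (cong (b ,_) (to-k (inj₁ f) (≢a (inj₁ f))))
      ... | inj₂ (refl , refl) = there (here (cong (_, b) (to-k (inj₂ f) (≢a (inj₂ f)))))

    without-ab : ¬ Ê a b → Goal
    without-ab ¬ab = (a , k) ∷ (k , a) ∷ (b , a) ∷ (b , k) ∷ (b′ , b) ∷ [] , m≤n⊔m (2 + n) 5 ,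
      [ memE , memF ]′
      where
      L = (a , k) ∷ (k , a) ∷ (b , a) ∷ (b , k) ∷ (b′ , b) ∷ []
      ≡k : ∀ {y} → Ê a y → y ≡ k
      ≡k ay = trans (to-l ay λ { refl → ¬ab ay }) (sym k≡l)
      memE : ∀ {x y} → E x y → (x , y) ∈ L
      memE {x} {y} e with starE e
      ... | inj₁ refl          = here (cong (a ,_) (≡k (inj₁ e)))
      ... | inj₂ (refl , refl) = there (here (cong (_, a) (≡k (inj₂ e))))
      memF : ∀ {x y} → F x y → (x , y) ∈ L
      memF {x} {y} f with starF f
      ... | inj₂ (refl , refl) = there (there (there (there (here refl))))
      ... | inj₁ refl with y Fin.≟ a
      ...   | yes refl = there (there (here refl))
      ...   | no y≢a   = there (there (there (here (cong (b ,_) (to-k (inj₁ f) y≢a)))))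

  by-centers : Dec (a ≡ b) → Goal
  by-centers (yes refl) = withStar a (a′ , a) (b′ , a)
    [ (λ e → place (outE e) inj₁ (starE e)) , (λ f → place (outF f) inj₂ (starF f)) ]′
    where
    place : ∀ {x y c} → x ≢ y → (∀ {p} → p ≡ (c , a) → p ≡ (a′ , a) ⊎ p ≡ (b′ , a)) →
      x ≡ a ⊎ x ≡ c × y ≡ a → (x ≡ a × a ≢ y) ⊎ (x , y) ≡ (a′ , a) ⊎ (x , y) ≡ (b′ , a)
    place x≢y i (inj₁ refl)          = inj₁ (refl , x≢y)
    place x≢y i (inj₂ (refl , refl)) = inj₂ (i refl)
  by-centers (no a≢b) with K? | L?
  ... | no none | _ = withStar b (b′ , b) (a , b) [ placeE , placeF ]′
    where
    to-b : ∀ {y} → Ê a y → y ≡ b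
    to-b ay = decidable-stable (_ Fin.≟ _) λ y≢b → none (_ , y≢b , ay)
    placeE : ∀ {x y} → E x y → (x ≡ b × b ≢ y) ⊎ (x , y) ≡ (b′ , b) ⊎ (x , y) ≡ (a , b)
    placeE e with starE e
    ... | inj₁ refl          = inj₂ (inj₂ (cong (a ,_) (to-b (inj₁ e))))
    ... | inj₂ (refl , refl) = inj₁ (to-b (inj₂ e) , a≢b ∘ sym)
    placeF : ∀ {x y} → F x y → (x ≡ b × b ≢ y) ⊎ (x , y) ≡ (b′ , b) ⊎ (x , y) ≡ (a , b)
    placeF f with starF f
    ... | inj₁ refl          = inj₁ (refl , outF f)
    ... | inj₂ (refl , refl) = inj₂ (inj₁ refl)
  ... | yes _ | no none = withStar a (a′ , a) (b , a) [ placeE , placeF ]′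
    where
    to-a : ∀ {y} → F̂ b y → y ≡ a
    to-a by = decidable-stable (_ Fin.≟ _) λ y≢a → none (_ , y≢a , by)
    placeF : ∀ {x y} → F x y → (x ≡ a × a ≢ y) ⊎ (x , y) ≡ (a′ , a) ⊎ (x , y) ≡ (b , a)
    placeF f with starF f
    ... | inj₁ refl          = inj₂ (inj₂ (cong (b ,_) (to-a (inj₁ f))))
    ... | inj₂ (refl , refl) = inj₁ (to-a (inj₂ f) , a≢b)
    placeE : ∀ {x y} → E x y → (x ≡ a × a ≢ y) ⊎ (x , y) ≡ (a′ , a) ⊎ (x , y) ≡ (b , a)
    placeE e with starE e
    ... | inj₁ refl          = inj₁ (refl , outE e)
    ... | inj₂ (refl , refl) = inj₂ (inj₁ refl)
  ... | yes (k , k≢b , ak) | yes (l , l≢a , bl) with E? a b ⊎-dec E? b a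
  ...   | yes ab = Triangle.with-ab a≢b k≢b ak l≢a bl ab
  ...   | no ¬ab = Triangle.without-ab a≢b k≢b ak l≢a bl ¬ab

-- With N = 3 + n there are N(N - 1) pairs to cover. For N ≥ 4, N - 2 graphs reach at most (N - 2)(N
-- + 1) = N(N - 1) - 2 of them; for N = 3, one graph reaches five out of six.
covered-pairs : ∀ {d} {E F : Fin d → Rel (Fin (3 + n)) 0ℓ} →
  (∀ j → Decidable (E j)) → (∀ j → Decidable (F j)) →
  (∀ j → HalfCover (E j)) → (∀ j → HalfCover (F j)) → (∀ j → Crossing (E j) (F j)) →
  (∀ i k → i ≢ k → ∃ λ j → E j i k ⊎ F j i k) → 2 + n ≤ d
covered-pairs {n} {d} E? F? halfE halfF cross cov = ≮⇒≥ λ d<2+n → <⇒≱ (too-few n) (begin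
  (3 + n) * (3 + n)                 ≤⟨ all-pairs≤ (diag ++ U) mem ⟩
  length (diag ++ U)                ≡⟨ length-++ diag ⟩
  length diag + length U            ≤⟨ +-mono-≤ (≤-reflexive length-diag) U≤ ⟩
  (3 + n) + d * ((4 + n) ⊔ 5)       ≤⟨ +-monoʳ-≤ (3 + n) (*-monoˡ-≤ _ (s≤s⁻¹ d<2+n)) ⟩
  (3 + n) + (1 + n) * ((4 + n) ⊔ 5) ∎)
  where
  open ≤-Reasoning
  few = λ j → few-pairs (E? j) (F? j) (halfE j) (halfF j) (cross j)
  union = length-union d (proj₁ ∘ few) (proj₁ ∘ proj₂ ∘ few)
  U = proj₁ union
  U≤ = proj₁ (proj₂ union)
  diag : List (Fin (3 + n) × Fin (3 + n))
  diag = map (λ i → i , i) (allFin (3 + n))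
  length-diag : length diag ≡ 3 + n
  length-diag = trans (length-map _ (allFin (3 + n))) (length-tabulate {n = 3 + n} id)
  mem : ∀ i k → (i , k) ∈ diag ++ U
  mem i k with i Fin.≟ k
  ... | yes refl = ∈-++⁺ˡ (∈-map⁺ _ (∈-allFin i))
  ... | no i≢k   = let j , c = cov i k i≢k in
                   ∈-++⁺ʳ diag (proj₂ (proj₂ union) j (proj₂ (proj₂ (few j)) c))
  square : ∀ k → (4 + k) * (4 + k) ≡ 2 + ((4 + k) + (2 + k) * (5 + k))
  square = solve-∀
  too-few : ∀ k → (3 + k) + (1 + k) * ((4 + k) ⊔ 5) < (3 + k) * (3 + k)
  too-few zero    = ≤-refl
  too-few (suc k) = subst₂ (λ B s → (4 + k) + (2 + k) * B < s)
    (sym (m≥n⇒m⊔n≡m {5 + k} {5} (m≤m+n 5 k))) (sym (square k)) (s≤s (n≤1+n _))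

third : (i k : Fin (3 + n)) → ∃ λ o → i ≢ o × k ≢ o
third i k with i Fin.≟ k
... | yes refl = punchIn i zero , punchInᵢ≢i i _ ∘ sym , punchInᵢ≢i i _ ∘ sym
... | no i≢k   = punchIn i (punchIn (punchOut i≢k) zero) , punchInᵢ≢i i _ ∘ sym ,
  λ eq → punchInᵢ≢i (punchOut i≢k) zero (punchIn-injective i _ _ (trans (sym eq) (sym (punchIn-punchOut i≢k))))

spike-else : ∀ (c : Fin n) b t s {k} → c ≢ k → t ≢ k → spike c b t s k ≡ 0
spike-else c b t s {k} c≢k t≢k with c Fin.≟ k | t Fin.≟ k
... | yes p | _     = ⊥-elim (c≢k p)
... | no _  | yes p = ⊥-elim (t≢k p)
... | no _  | no _  = refl

spike-swap : ∀ (c t k : Fin n) → spike c 1 t 1 k ≡ spike t 1 c 1 k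
spike-swap c t k with c Fin.≟ k | t Fin.≟ k
... | yes _ | yes _ = refl
... | yes _ | no _  = refl
... | no _  | yes _ = refl
... | no _  | no _  = refl

module AllOnes (m : Vec ℕ (3 + n)) (m≡1 : ∀ i → lookup m i ≡ 1) where

  1≤m : ∀ i → 1 ≤ lookup m i
  1≤m i = ≤-reflexive (sym (m≡1 i))

  abstract

    -- m − e_i − e_k for i ≢ k, but m − e_i for i = k, as spike does not add up.
    X : (i k : Fin (3 + n)) → Vertex m
    X i k = co m (spike i 1 k 1) (i , ≤-reflexive (sym (spike-c i 1 k 1)) , 1≤m i)
      (let o , i≢o , k≢o = third i k in o , subst (_< lookup m o) (sym (spike-else i 1 k 1 i≢o k≢o)) (1≤m o))

    X-at : ∀ i k j → X i k at j ≡ lookup m j ∸ spike i 1 k 1 j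
    X-at i k = lookup∘tabulate λ j → lookup m j ∸ spike i 1 k 1 j

    X-swap : ∀ i k → X i k ≡ X k i
    X-swap i k = vertex-≗ λ j → trans (X-at i k j) (trans (cong (lookup m j ∸_) (spike-swap i k j)) (sym (X-at k i j)))

    X-covers : ∀ {i k i′ k′} → i ≢ i′ → i ≢ k′ → k ≢ i′ → k ≢ k′ → Covers (X i k) (X i′ k′)
    X-covers {i} {k} {i′} {k′} p q r s j =
      subst₂ (λ x y → lookup m j ≤ x + y) (sym (X-at i k j)) (sym (X-at i′ k′ j))
        (∸-covers (spike i 1 k 1 j) (spike i′ 1 k′ 1 j)
          (spike-conflict m p (1≤m i) (1≤m i′) (1≤m k) (1≤m k′) (⊥-elim ∘ q) (⊥-elim ∘ r ∘ sym) (⊥-elim ∘ s) j))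

    X-zero : ∀ i k → X i k at i ≡ 0
    X-zero i k = trans (X-at i k i) (trans (cong₂ _∸_ (m≡1 i) (spike-c i 1 k 1)) (n∸n≡0 1))

    X-gap : ∀ i k → ∃ λ j → X i i at j + X i k at j < lookup m j
    X-gap i k = i , subst₂ (λ x y → x + y < lookup m i) (sym (X-zero i i)) (sym (X-zero i k)) (1≤m i)

    X-distinct : ∀ {i k} → i ≢ k → X i i ≢ X i k
    X-distinct {i} {k} i≢k eq = 1≢0 (trans (sym one) (trans (cong (_at k) (trans eq (X-swap i k))) (X-zero k i)))
      where
      one : X i i at k ≡ 1
      one = trans (X-at i i k) (cong₂ _∸_ (m≡1 k) (spike-else i 1 i 1 i≢k i≢k))
      1≢0 : ¬ 1 ≡ 0
      1≢0 ()

  -- The relation is abstract so as to serve for an interval order and for its converse.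
  module Half (_⊏_ : Rel (Vertex m) 0ℓ) (⋢ : ∀ {v w} → Covers v w → ¬ v ⊏ w)
    (irr : ∀ {v} → ¬ v ⊏ v)
    (ferrers : ∀ {a b c d} → a ⊏ b → c ⊏ d → ¬ ¬ (a ⊏ d ⊎ c ⊏ b)) where

    E : Rel (Fin (3 + n)) 0ℓ
    E i k = X i i ⊏ X i k

    linked : ∀ {i k i′ k′} → E i k → E i′ k′ → i ≢ i′ → i ≢ k′ → i′ ≢ k → ⊥
    linked e e′ p q r = ferrers e e′
      [ ⋢ (X-covers p q p q) , ⋢ (X-covers (p ∘ sym) r (p ∘ sym) r) ]′

    half : HalfCover E
    half = record { loopless = irr ; linked = linked ; acyclic = acyclic }
      where
      acyclic : ∀ {a b c} → E a b → E b c → E c a → ⊥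
      -- The second alternative amounts to `E b a`, as `X a b` equals `X b a`; together with `E c a`
      -- it violates `linked`.
      acyclic {a} {b} {c} ab bc ca = ferrers ab bc
        [ ⋢ (X-covers a≢b a≢c a≢b a≢c)
        , (λ b⊏ab → linked (subst (X b b ⊏_) (X-swap a b) b⊏ab) ca b≢c (a≢b ∘ sym) (a≢c ∘ sym)) ]′
        where
        a≢b : a ≢ b
        a≢b refl = irr ab
        b≢c : b ≢ c
        b≢c refl = irr bc
        a≢c : a ≢ c
        a≢c refl = irr ca

  -- The conclusion is decidable, so the finitely many instances of both relations may be taken as
  -- decided.
  n-1≤box-ones : ∀ {d} → IsIntersectionOfIntervalGraphs (D m) d → 2 + n ≤ d
  n-1≤box-ones {d} rep = decidable-stable (2 + n ≤? d)
    (¬¬-choice (λ j → ¬¬-choice λ i → ¬¬-choice λ k → ¬¬-excluded-middle) >>= λ E? →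
     ¬¬-choice (λ j → ¬¬-choice λ i → ¬¬-choice λ k → ¬¬-excluded-middle) >>= λ F? →
     ¬¬-choice (λ i → ¬¬-choice λ k → coverage i k) >>= λ cov k →
     k (covered-pairs E? F? R.half L.half crossing cov))
    where
    open Orders rep
    module R (j : Fin d) = Half (λ v w → v ⊏[ j ] w) (λ {v} {w} → covers⇒⋢ {j} {v} {w}) (O.⊏-irr j) (O.ferrers j)
    module L (j : Fin d) = Half (λ v w → w ⊏[ j ] v)
      (λ {v} {w} cov → covers⇒⋢ {j} {w} {v} λ i →
        subst (lookup m i ≤_) (+-comm (v at i) (w at i)) (cov i))
      (O.⊏-irr j) (λ p q → ¬¬-map Sum.swap (O.ferrers j p q))
    crossing : ∀ j → Crossing (R.E j) (L.E j)
    crossing j = record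
      { meeting  = λ {i} {k} {i′} {k′} e f p q r s → O.ferrers j e f
          [ covers⇒⋢ {j} (X-covers p p p p) , covers⇒⋢ {j} (X-covers (p ∘ sym) (r ∘ sym) (q ∘ sym) (s ∘ sym)) ]′
      -- In this law and the next the two gaps share the vertex m - e_i - e_k, on opposite sides, so
      -- one Ferrers alternative puts a vertex beside itself.
      ; distinct = λ e f → O.ferrers j e f [ O.⊏-irr j , O.⊏-irr j ]′
      ; reversed = λ {i} {k} e f →
          let i≢k = λ { refl → O.⊏-irr j e } in
          O.ferrers j e f
            [ covers⇒⋢ {j} (X-covers i≢k i≢k i≢k i≢k)
            , O.⊏-irr j ∘ subst (λ v → v ⊏[ j ] X i k) (X-swap k i) ]′
      }
    coverage : ∀ i k → ¬ ¬ (i ≢ k → ∃ λ j → R.E j i k ⊎ L.E j i k)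
    coverage i k with i Fin.≟ k
    ... | yes i≡k = λ ¬c → ¬c λ i≢k → ⊥-elim (i≢k i≡k)
    ... | no i≢k  = λ ¬c → separated (X-distinct i≢k) (X-gap i k) λ c → ¬c λ _ → c

-- Assembly of the six cases

theorem42 : (n : ℕ) → n ≥ 2 → (m : Vec ℕ n) → (∀ i → lookup m i ≥ 1) →
    ((∃ λ i → lookup m i ≥ 4) → IsBoxicity (D m) n) ×
    ((∃ λ i → lookup m i ≡ 3 × (∃ λ j → j ≢ i × lookup m j ≥ 2)) → IsBoxicity (D m) n) ×
    ((∃ λ i → lookup m i ≡ 3 × (∀ j → j ≢ i → lookup m j ≡ 1)) → IsBoxicity (D m) (n ∸ 1)) ×
    (m ≡ replicate n 2 → IsBoxicity (D m) n) ×
    ((∀ i → lookup m i ≡ 1 ⊎ lookup m i ≡ 2) → m ≢ replicate n 2 → toList m ≢ 1 ∷ 1 ∷ [] → IsBoxicity (D m) (n ∸ 1)) ×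
    (toList m ≡ 1 ∷ 1 ∷ [] → IsBoxicity (D m) 0)
theorem42 (suc (suc n)) (s≤s (s≤s z≤n)) m m≥1 =
  (λ (i , 4≤mi) → box≤n m , λ _ →
     n≤box-four m m≥1 i 4≤mi (punchIn i zero) (punchInᵢ≢i i zero ∘ sym)) ,
  (λ (i , mi≡3 , j , j≢i , 2≤mj) → box≤n m , λ _ →
     n≤box-three m m≥1 i j (j≢i ∘ sym) mi≡3 2≤mj) ,
  (λ (i , mi≡3 , m≡1) →
     box≤n-1-three m i mi≡3 m≡1 (punchIn i zero) (punchInᵢ≢i i zero) , λ _ →
     n-1≤box m m≥1 i (subst (2 ≤_) (sym mi≡3) (n≤1+n 2))) ,
  (λ m≡2s → box≤n m , λ _ →
     n≤box-twos m λ i → trans (cong (λ v → lookup v i) m≡2s) (lookup-replicate i 2)) ,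
  (λ m12 m≢2s m≢11 →
     let z , mz≡1 = some-one m12 m≢2s in
     box≤n-1 m m12 z mz≡1 , λ _ → ones-and-twos m m≥1 m12 m≢11) ,
  (λ m≡11 → box-1-1 m m≡11 , λ _ _ → z≤n)
  where
  some-one : (∀ i → lookup m i ≡ 1 ⊎ lookup m i ≡ 2) → m ≢ replicate (2 + n) 2 →
    ∃ λ z → lookup m z ≡ 1
  some-one m12 m≢2s = decidable-stable (any? λ z → lookup m z ≟ 1) λ none →
    m≢2s (Pointwise-≡⇒≡ (ext λ i →
      trans ([ (λ mi≡1 → ⊥-elim (none (i , mi≡1))) , id ]′ (m12 i)) (sym (lookup-replicate i 2))))

  ones-and-twos : ∀ {n} (m : Vec ℕ (2 + n)) → (∀ i → lookup m i ≥ 1) →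
    (∀ i → lookup m i ≡ 1 ⊎ lookup m i ≡ 2) → toList m ≢ 1 ∷ 1 ∷ [] →
    ∀ {d} → IsIntersectionOfIntervalGraphs (D m) d → 1 + n ≤ d
  ones-and-twos m m≥1 m12 m≢11 with any? (λ t → 2 ≤? lookup m t)
  ... | yes (t , 2≤mt) = n-1≤box m m≥1 t 2≤mt
  ... | no none = all-ones m m≢11 λ i →
    [ id , (λ mi≡2 → ⊥-elim (none (i , ≤-reflexive (sym mi≡2)))) ]′ (m12 i)
    where
    all-ones : ∀ {n} (m : Vec ℕ (2 + n)) → toList m ≢ 1 ∷ 1 ∷ [] → (∀ i → lookup m i ≡ 1) →
      ∀ {d} → IsIntersectionOfIntervalGraphs (D m) d → 1 + n ≤ d
    all-ones {zero}  (x ∷ y ∷ []) m≢11 m≡1 =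
      ⊥-elim (m≢11 (cong₂ (λ x y → x ∷ y ∷ []) (m≡1 zero) (m≡1 (suc zero))))
    all-ones {suc n} m            _    m≡1 = AllOnes.n-1≤box-ones m m≡1
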